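{- The theory $\mathsf{ITB}+\exists\alpha(\alpha=\alpha)$ proves that there exists a $\prec$-minimal index. Equivalently, the theory $\mathsf{DTB}:=\mathsf{ITB}+\forall\alpha\exists\beta(\beta\prec\alpha)+\exists\alpha(\alpha=\alpha)$ is inconsistent.
   Context: $\mathsf{ITB}$ (iterated truth biconditionals) is a two-sorted first-order theory, in a many-sorted logic allowing the domain of a sort to be empty. The first sort (variables $x,y,z,\dots$) is for natural numbers, the second sort (variables $\alpha,\beta,\gamma,\dots$) is for indices. The language $\mathcal{L}_{\mathsf{ITB}}$ consists of the arithmetic language $\{+,\cdot,\mathsf{S},<,0\}$ on the number sort together with a binary relation $\alpha\prec\beta$ on indices and a binary predicate $\mathsf{T}_\alpha(x)$ (index $\alpha$, number $x$). Axioms: the axioms of Robinson's arithmetic $\mathsf{Q}$; axioms stating that $\prec$ is a strict partial order; and for every $\mathcal{L}_{\mathsf{ITB}}$-sentence $\varphi$ the biconditional $\mathsf{B}_\varphi:=\forall\alpha(\mathsf{T}_\alpha(\ulcorner\varphi\urcorner)\leftrightarrow\varphi^{\prec\alpha})$, where $\ulcorner\varphi\urcorner$ is the numeral of the Gödel number of $\varphi$ (under a standard Gödel numbering of $\mathcal{L}_{\mathsf{ITB}}$) and $\varphi^{\prec\alpha}$ is $\varphi$ with every index quantifier $\forall\beta$ / $\exists\beta$ replaced by $\forall\beta\prec\alpha$ / $\exists\beta\prec\alpha$ (renaming bound variables as needed). -}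

module Defs where

open import Data.Nat using (ℕ; zero; suc; _+_; _*_; _^_)
open import Data.Fin using (Fin; zero; suc; toℕ)
open import Data.List using (List; []; _∷_; map)
open import Data.List.Membership.Propositional using (_∈_)
open import Data.Sum using (_⊎_)
open import Relation.Binary.PropositionalEquality using (_≡_)

-- Syntax of L_ITB (two-sorted, de Bruijn indices).
-- Tm n     : number terms with n free number variables.
-- Fm n m   : formulas with n free number variables and m free index
--            variables.  Index terms are just index variables (Fin m).
-- Primitive connectives: ⊥, ⇒, ∀ (one for each sort); the others are
-- the usual classical abbreviations.  Equality is available on both sorts.

data Tm (n : ℕ) : Set where
  var : Fin n → Tm n
  zer : Tm n
  S   : Tm n → Tm n
  _⊕_ : Tm n → Tm n → Tm n
  _⊗_ : Tm n → Tm n → Tm n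

data Fm (n m : ℕ) : Set where
  _≐_  : Tm n → Tm n → Fm n m
  _<'_ : Tm n → Tm n → Fm n m
  _≈ᵢ_ : Fin m → Fin m → Fm n m
  _≺_  : Fin m → Fin m → Fm n m
  T    : Fin m → Tm n → Fm n m
  ⊥'   : Fm n m
  _⇒_  : Fm n m → Fm n m → Fm n m
  ∀ₙ   : Fm (suc n) m → Fm n m
  ∀ᵢ   : Fm n (suc m) → Fm n m

infixr 5 _⇒_

¬' : ∀ {n m} → Fm n m → Fm n m
¬' φ = φ ⇒ ⊥'

_∧'_ : ∀ {n m} → Fm n m → Fm n m → Fm n m
φ ∧' ψ = ¬' (φ ⇒ ¬' ψ)

_⇔_ : ∀ {n m} → Fm n m → Fm n m → Fm n m
φ ⇔ ψ = (φ ⇒ ψ) ∧' (ψ ⇒ φ)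

∃ₙ : ∀ {n m} → Fm (suc n) m → Fm n m
∃ₙ φ = ¬' (∀ₙ (¬' φ))

∃ᵢ : ∀ {n m} → Fm n (suc m) → Fm n m
∃ᵢ φ = ¬' (∀ᵢ (¬' φ))

Sentence : Set
Sentence = Fm 0 0

renT : ∀ {n n'} → (Fin n → Fin n') → Tm n → Tm n'
renT ρ (var i) = var (ρ i)
renT ρ zer = zer
renT ρ (S t) = S (renT ρ t)
renT ρ (t ⊕ u) = renT ρ t ⊕ renT ρ u
renT ρ (t ⊗ u) = renT ρ t ⊗ renT ρ u

substT : ∀ {n n'} → (Fin n → Tm n') → Tm n → Tm n'
substT σ (var i) = σ i
substT σ zer = zer
substT σ (S t) = S (substT σ t)
substT σ (t ⊕ u) = substT σ t ⊕ substT σ u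
substT σ (t ⊗ u) = substT σ t ⊗ substT σ u

liftS : ∀ {n n'} → (Fin n → Tm n') → Fin (suc n) → Tm (suc n')
liftS σ zero = var zero
liftS σ (suc i) = renT suc (σ i)

liftR : ∀ {m m'} → (Fin m → Fin m') → Fin (suc m) → Fin (suc m')
liftR ρ zero = zero
liftR ρ (suc i) = suc (ρ i)

substF : ∀ {n n' m} → (Fin n → Tm n') → Fm n m → Fm n' m
substF σ (s ≐ t) = substT σ s ≐ substT σ t
substF σ (s <' t) = substT σ s <' substT σ t
substF σ (a ≈ᵢ b) = a ≈ᵢ b
substF σ (a ≺ b) = a ≺ b
substF σ (T a t) = T a (substT σ t)
substF σ ⊥' = ⊥'
substF σ (φ ⇒ ψ) = substF σ φ ⇒ substF σ ψ
substF σ (∀ₙ φ) = ∀ₙ (substF (liftS σ) φ)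
substF σ (∀ᵢ φ) = ∀ᵢ (substF σ φ)

renI : ∀ {n m m'} → (Fin m → Fin m') → Fm n m → Fm n m'
renI ρ (s ≐ t) = s ≐ t
renI ρ (s <' t) = s <' t
renI ρ (a ≈ᵢ b) = ρ a ≈ᵢ ρ b
renI ρ (a ≺ b) = ρ a ≺ ρ b
renI ρ (T a t) = T (ρ a) t
renI ρ ⊥' = ⊥'
renI ρ (φ ⇒ ψ) = renI ρ φ ⇒ renI ρ ψ
renI ρ (∀ₙ φ) = ∀ₙ (renI ρ φ)
renI ρ (∀ᵢ φ) = ∀ᵢ (renI (liftR ρ) φ)

sub0 : ∀ {n} → Tm n → Fin (suc n) → Tm n
sub0 t zero = t
sub0 t (suc i) = var i

_[_]ₙ : ∀ {n m} → Fm (suc n) m → Tm n → Fm n m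
φ [ t ]ₙ = substF (sub0 t) φ

ren0 : ∀ {m} → Fin m → Fin (suc m) → Fin m
ren0 b zero = b
ren0 b (suc i) = i

_[_]ᵢ : ∀ {n m} → Fm n (suc m) → Fin m → Fm n m
φ [ b ]ᵢ = renI (ren0 b) φ

wkN : ∀ {n m} → Fm n m → Fm (suc n) m
wkN = substF (λ i → var (suc i))

wkI : ∀ {n m} → Fm n m → Fm n (suc m)
wkI = renI suc

closeTm : ∀ {n} → Fin 0 → Tm n
closeTm ()

closeIx : ∀ {m} → Fin 0 → Fin m
closeIx ()

embed : ∀ {n m} → Sentence → Fm n m
embed φ = renI closeIx (substF closeTm φ)

-- Relativisation φ^{≺α}: every index quantifier ∀β becomes ∀β(β≺α → …)
-- (hence ∃β becomes ∃β(β≺α ∧ …)).  α is an index variable.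

rel : ∀ {n m} → Fin m → Fm n m → Fm n m
rel a (s ≐ t) = s ≐ t
rel a (s <' t) = s <' t
rel a (b ≈ᵢ c) = b ≈ᵢ c
rel a (b ≺ c) = b ≺ c
rel a (T b t) = T b t
rel a ⊥' = ⊥'
rel a (φ ⇒ ψ) = rel a φ ⇒ rel a ψ
rel a (∀ₙ φ) = ∀ₙ (rel a φ)
rel a (∀ᵢ φ) = ∀ᵢ ((zero ≺ suc a) ⇒ rel (suc a) φ)

pair : ℕ → ℕ → ℕ
pair a b = 2 ^ a * suc (2 * b)

codeT : ∀ {n} → Tm n → ℕ
codeT (var i) = pair 0 (toℕ i)
codeT zer = pair 1 0
codeT (S t) = pair 2 (codeT t)
codeT (t ⊕ u) = pair 3 (pair (codeT t) (codeT u))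
codeT (t ⊗ u) = pair 4 (pair (codeT t) (codeT u))

gn : ∀ {n m} → Fm n m → ℕ
gn (s ≐ t) = pair 0 (pair (codeT s) (codeT t))
gn (s <' t) = pair 1 (pair (codeT s) (codeT t))
gn (a ≈ᵢ b) = pair 2 (pair (toℕ a) (toℕ b))
gn (a ≺ b) = pair 3 (pair (toℕ a) (toℕ b))
gn (T a t) = pair 4 (pair (toℕ a) (codeT t))
gn ⊥' = pair 5 0
gn (φ ⇒ ψ) = pair 6 (pair (gn φ) (gn ψ))
gn (∀ₙ φ) = pair 7 (gn φ)
gn (∀ᵢ φ) = pair 8 (gn φ)

num : ∀ {n} → ℕ → Tm n
num zero = zer
num (suc k) = S (num k)

⌜_⌝ : ∀ {n} → Sentence → Tm n
⌜ φ ⌝ = num (gn φ)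

private
  v0 : ∀ {n} → Tm (suc n)
  v0 = var zero
  v1 : ∀ {n} → Tm (suc (suc n))
  v1 = var (suc zero)
  v2 : ∀ {n} → Tm (suc (suc (suc n)))
  v2 = var (suc (suc zero))

-- Robinson's Q (with < as primitive, defined by axiom Q8)
Q1 Q2 Q3 Q4 Q5 Q6 Q7 Q8 : Sentence
Q1 = ∀ₙ (¬' (S v0 ≐ zer))
Q2 = ∀ₙ (∀ₙ ((S v1 ≐ S v0) ⇒ (v1 ≐ v0)))
Q3 = ∀ₙ (¬' (v0 ≐ zer) ⇒ ∃ₙ (v1 ≐ S v0))
Q4 = ∀ₙ ((v0 ⊕ zer) ≐ v0)
Q5 = ∀ₙ (∀ₙ ((v1 ⊕ S v0) ≐ S (v1 ⊕ v0)))
Q6 = ∀ₙ ((v0 ⊗ zer) ≐ zer)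
Q7 = ∀ₙ (∀ₙ ((v1 ⊗ S v0) ≐ ((v1 ⊗ v0) ⊕ v1)))
Q8 = ∀ₙ (∀ₙ ((v1 <' v0) ⇔ ∃ₙ ((S v0 ⊕ v2) ≐ v1)))

Irrefl Trans : Sentence
Irrefl = ∀ᵢ (¬' (zero ≺ zero))
Trans = ∀ᵢ (∀ᵢ (∀ᵢ (((suc (suc zero) ≺ suc zero) ∧' (suc zero ≺ zero))
                    ⇒ (suc (suc zero) ≺ zero))))

B : Sentence → Sentence
B φ = ∀ᵢ (T zero ⌜ φ ⌝ ⇔ rel zero (wkI φ))

Theory : Set₁
Theory = Sentence → Set

data ITB : Theory where
  q1 : ITB Q1
  q2 : ITB Q2
  q3 : ITB Q3
  q4 : ITB Q4
  q5 : ITB Q5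
  q6 : ITB Q6
  q7 : ITB Q7
  q8 : ITB Q8
  irrefl : ITB Irrefl
  trans  : ITB Trans
  bicond : (φ : Sentence) → ITB (B φ)

_+ax_ : Theory → Sentence → Theory
(Th +ax ψ) φ = Th φ ⊎ φ ≡ ψ

-- Classical many-sorted first-order natural deduction with explicit
-- variable contexts (sound and complete for semantics where domains may
-- be empty: ∀-elimination needs an actual term/variable in scope).

data Prf (Ax : Theory) : (n m : ℕ) → List (Fm n m) → Fm n m → Set where
  ax   : ∀ {n m Γ} {φ : Sentence} → Ax φ → Prf Ax n m Γ (embed φ)
  hyp  : ∀ {n m Γ φ} → φ ∈ Γ → Prf Ax n m Γ φ
  ⇒I   : ∀ {n m Γ φ ψ} → Prf Ax n m (φ ∷ Γ) ψ → Prf Ax n m Γ (φ ⇒ ψ)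
  ⇒E   : ∀ {n m Γ φ ψ} → Prf Ax n m Γ (φ ⇒ ψ) → Prf Ax n m Γ φ → Prf Ax n m Γ ψ
  dne  : ∀ {n m Γ φ} → Prf Ax n m Γ (¬' (¬' φ)) → Prf Ax n m Γ φ
  ∀ₙI  : ∀ {n m Γ φ} → Prf Ax (suc n) m (map wkN Γ) φ → Prf Ax n m Γ (∀ₙ φ)
  ∀ₙE  : ∀ {n m Γ φ} → Prf Ax n m Γ (∀ₙ φ) → (t : Tm n) → Prf Ax n m Γ (φ [ t ]ₙ)
  ∀ᵢI  : ∀ {n m Γ φ} → Prf Ax n (suc m) (map wkI Γ) φ → Prf Ax n m Γ (∀ᵢ φ)
  ∀ᵢE  : ∀ {n m Γ φ} → Prf Ax n m Γ (∀ᵢ φ) → (b : Fin m) → Prf Ax n m Γ (φ [ b ]ᵢ)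
  reflₙ : ∀ {n m Γ} (t : Tm n) → Prf Ax n m Γ (t ≐ t)
  reflᵢ : ∀ {n m Γ} (b : Fin m) → Prf Ax n m Γ (b ≈ᵢ b)
  substₙ : ∀ {n m Γ s t} (φ : Fm (suc n) m) →
           Prf Ax n m Γ (s ≐ t) → Prf Ax n m Γ (φ [ s ]ₙ) → Prf Ax n m Γ (φ [ t ]ₙ)
  substᵢ : ∀ {n m Γ a b} (φ : Fm n (suc m)) →
           Prf Ax n m Γ (a ≈ᵢ b) → Prf Ax n m Γ (φ [ a ]ᵢ) → Prf Ax n m Γ (φ [ b ]ᵢ)

_⊢_ : Theory → Sentence → Set
Th ⊢ φ = Prf Th 0 0 [] φ

NonemptyIx : Sentence
NonemptyIx = ∃ᵢ (zero ≈ᵢ zero)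

MinimalExists : Sentence
MinimalExists = ∃ᵢ (∀ᵢ (¬' (zero ≺ suc zero)))

NoMinimal : Sentence
NoMinimal = ∀ᵢ (∃ᵢ (zero ≺ suc zero))

DTB : Theory
DTB = (ITB +ax NoMinimal) +ax NonemptyIx

{-# OPTIONS --safe #-}
module Submission where

-- Let λ be a sentence with λ ↔ ∀α ¬T_α(⌜λ⌝), so that T_α(⌜λ⌝) ↔ ∀β≺α ¬T_β(⌜λ⌝). Assume that no index is minimal.
-- If T_α(⌜λ⌝), pick β≺α; then ¬T_β(⌜λ⌝), while ¬T_γ(⌜λ⌝) for all γ≺β by transitivity, i.e. T_β(⌜λ⌝).
-- Hence T_α(⌜λ⌝) for no α, which in turn makes it true for every α, and some α exists.
--
-- The diagonalisation is done for this one sentence only. λ reads ∀α∀x,z,u,w,h (x ≐ t ⇒ C), where C does not depend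
-- on t and t = z⊗(z⊗⋯(z⊗N)) with N factors z, N = 2 gn(C) + 1, and C forces z = 2. The value 2^N · N of t thus
-- determines gn(C), and the code c of t is given by a polynomial equation in V = 2^N, so the only non-polynomial
-- ingredient of gn(λ) is the factor 2^gn(x≐t) = 2^(8c+5). C singles out that power of two by a bounded formula
-- with a least witness u, and says that T_α does not hold of the number assembled from it.
-- Robinson arithmetic decides bounded formulas at numerals, and compares every number with a numeral.

open import Defs renaming (_⊕_ to infixl 25 _⊕_; _⊗_ to infixl 26 _⊗_)
open import Data.Nat
open import Data.Nat.Properties
open import Data.Nat.Induction using (<-rec)
open import Data.Nat.Tactic.RingSolver using (solve-∀)
open import Data.Fin using (Fin; zero; suc; #_)
open import Data.List using (List; []; _∷_; map)
open import Data.List.Relation.Unary.Any using (here; there)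
open import Data.List.Relation.Binary.Subset.Propositional using (_⊆_)
open import Data.List.Relation.Binary.Subset.Propositional.Properties using (map⁺; ∷⁺ʳ)
open import Data.Product using (_×_; _,_; ∃; proj₁; proj₂)
open import Data.Sum using (_⊎_; inj₁; inj₂)
open import Data.Empty using (⊥; ⊥-elim)
open import Function using (_∘_)
open import Relation.Nullary using (¬_; Dec; yes; no)
open import Relation.Nullary.Decidable using (¬?; _×-dec_; decidable-stable)
open import Relation.Binary.PropositionalEquality using (_≡_; _≢_; refl; sym; cong; cong₂; subst; module ≡-Reasoning) renaming (trans to ≡-trans)

-- Powers of two

halve : ∀ n → (∃ λ k → n ≡ k * 2) ⊎ (∃ λ k → n ≡ suc (k * 2))
halve zero = inj₁ (0 , refl)
halve (suc n) with halve n
... | inj₁ (k , eq) = inj₂ (k , cong suc eq)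
... | inj₂ (k , eq) = inj₁ (suc k , cong suc eq)

n*2≢1+m*2 : ∀ k l → k * 2 ≡ suc (l * 2) → ⊥
n*2≢1+m*2 (suc k) (suc l) eq = n*2≢1+m*2 k l (suc-injective (suc-injective eq))

-- The factor `d * 2 + 3` is odd and at least 3, and `e = 0` is allowed, so 0 has one as well and
-- exactly the powers of two have none.
HasOddFactor : ℕ → Set
HasOddFactor w = ∃ λ d → d < suc w × ∃ λ e → e < suc w × (d * 2 + 3) * e ≡ w

-- An odd factor of k is one of `k * 2`, which settles even numbers by induction; an odd number
-- above 1 is its own odd factor.
oddFactorFree⇒power : ∀ w → ¬ HasOddFactor w → ∃ λ b → w ≡ 2 ^ b
oddFactorFree⇒power = <-rec _ step
  where
  step : ∀ w → (∀ {v} → v < w → ¬ HasOddFactor v → ∃ λ b → v ≡ 2 ^ b) →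
         ¬ HasOddFactor w → ∃ λ b → w ≡ 2 ^ b
  step w rec free with halve w
  ... | inj₁ (zero , refl) = ⊥-elim (free (0 , s≤s z≤n , 0 , s≤s z≤n , refl))
  ... | inj₁ (suc k , refl) with rec {suc k} lt half
    where
    lt : suc k < suc k * 2
    lt = s≤s (s≤s (m≤m*n k 2))
    half : ¬ HasOddFactor (suc k)
    half (d , d< , e , e< , eq) = free
      (d , ≤-trans d< (s≤s (<⇒≤ lt)) , e * 2 , s≤s (*-monoˡ-≤ 2 (≤-pred e<)) ,
       ≡-trans (sym (*-assoc (d * 2 + 3) e 2)) (cong (_* 2) eq))
  ...   | b , eq = suc b , ≡-trans (cong (_* 2) eq) (*-comm (2 ^ b) 2)
  step w rec free | inj₂ (zero , refl) = 0 , refl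
  step w rec free | inj₂ (suc k , refl) = ⊥-elim (free
    (k , s≤s (≤-trans (m≤m*n k 2) (m≤n+m (k * 2) 3)) , 1 , s≤s (s≤s z≤n) ,
     ≡-trans (*-identityʳ (k * 2 + 3)) (+-comm (k * 2) 3)))

odd*≡2^⇒1 : ∀ b d e → suc (d * 2) * e ≡ 2 ^ b → d ≡ 0
odd*≡2^⇒1 zero d e eq with m*n≡1⇒m≡1 (suc (d * 2)) e eq
odd*≡2^⇒1 zero zero e eq | _ = refl
odd*≡2^⇒1 (suc b) d e eq with halve e
... | inj₁ (k , refl) = odd*≡2^⇒1 b d k
      (*-cancelʳ-≡ _ _ 2 (≡-trans (*-assoc (suc (d * 2)) k 2) (≡-trans eq (*-comm 2 (2 ^ b)))))
... | inj₂ (k , refl) = ⊥-elim (n*2≢1+m*2 (2 ^ b) (k + d + d * (k * 2))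
      (≡-trans (*-comm (2 ^ b) 2) (≡-trans (sym eq) (lem d k))))
  where
  lem : ∀ d k → suc (d * 2) * suc (k * 2) ≡ suc ((k + d + d * (k * 2)) * 2)
  lem = solve-∀

power⇒oddFactorFree : ∀ b → ¬ HasOddFactor (2 ^ b)
power⇒oddFactorFree b (d , _ , e , _ , eq)
  with odd*≡2^⇒1 b (suc d) e (≡-trans (cong (_* e) (lem d)) eq)
  where
  lem : ∀ d → suc (suc d * 2) ≡ d * 2 + 3
  lem = solve-∀
... | ()

-- This is what recovers both N and `2 ^ N` from their product, N being odd.
power*odd-injective : ∀ i j a b → 2 ^ i * suc (a * 2) ≡ 2 ^ j * suc (b * 2) → i ≡ j × a ≡ b
power*odd-injective zero zero a b eq =
  refl , *-cancelʳ-≡ a b 2 (suc-injective (≡-trans (sym (+-identityʳ _)) (≡-trans eq (+-identityʳ _))))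
power*odd-injective zero (suc j) a b eq = ⊥-elim (n*2≢1+m*2 (2 ^ j * suc (b * 2)) a
  (≡-trans (lem (2 ^ j) (suc (b * 2))) (≡-trans (sym eq) (+-identityʳ _))))
  where
  lem : ∀ x y → x * y * 2 ≡ 2 * x * y
  lem = solve-∀
power*odd-injective (suc i) zero a b eq = ⊥-elim (n*2≢1+m*2 (2 ^ i * suc (a * 2)) b
  (≡-trans (lem (2 ^ i) (suc (a * 2))) (≡-trans eq (+-identityʳ _))))
  where
  lem : ∀ x y → x * y * 2 ≡ 2 * x * y
  lem = solve-∀
power*odd-injective (suc i) (suc j) a b eq
  with power*odd-injective i j a b (*-cancelˡ-≡ _ _ 2
         (≡-trans (sym (*-assoc 2 (2 ^ i) _)) (≡-trans eq (*-assoc 2 (2 ^ j) _))))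
... | refl , refl = refl , refl

n<2^n : ∀ n → n < 2 ^ n
n<2^n zero = s≤s z≤n
n<2^n (suc n) = begin-strict
  suc n            <⟨ s≤s (n<2^n n) ⟩
  1 + 2 ^ n        ≤⟨ +-monoˡ-≤ (2 ^ n) (m^n>0 2 n) ⟩
  2 ^ n + 2 ^ n    ≡⟨ cong (2 ^ n +_) (sym (+-identityʳ (2 ^ n))) ⟩
  2 ^ suc n        ∎
  where open ≤-Reasoning

2^-injective : ∀ i j → 2 ^ i ≡ 2 ^ j → i ≡ j
2^-injective i j eq = proj₁ (power*odd-injective i j 0 0 (cong (_* 1) eq))

-- Exponents read off from congruences

-- The binomial expansion modulo `d * d`: the exponent turns into the coefficient of a linear term.
power-expansion : ∀ d m → ∃ λ r → suc d ^ m ≡ suc (m * d + r * (d * d))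
power-expansion d zero = 0 , refl
power-expansion d (suc m) with power-expansion d m
... | r , eq = r + m + r * d , ≡-trans (cong (suc d *_) eq) (lem d m r)
  where
  lem : ∀ d m r → suc d * suc (m * d + r * (d * d)) ≡ suc (suc m * d + (r + m + r * d) * (d * d))
  lem = solve-∀

-- Reduction mod d = 2^a − 1: a remainder b < a would leave 2^b − 1 < d divisible by d.
root-of-power : ∀ a d b x → suc d ≡ 2 ^ suc a → 2 ^ b ≡ suc (x * d) → ∃ λ j → 2 ^ b ≡ suc d ^ j
root-of-power a d = <-rec _ step
  where
  Goal : ℕ → Set
  Goal b = ∀ x → suc d ≡ 2 ^ suc a → 2 ^ b ≡ suc (x * d) → ∃ λ j → 2 ^ b ≡ suc d ^ j
  step : ∀ b → (∀ {b'} → b' < b → Goal b') → Goal b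
  step b rec x q≡ eq with suc a ≤? b
  ... | no b<a = 0 , small x eq
    where
    2^b<q : 2 ^ b < suc d
    2^b<q = subst (2 ^ b <_) (sym q≡) (^-monoʳ-< 2 (s≤s (s≤s z≤n)) (≰⇒> b<a))
    small : ∀ x → 2 ^ b ≡ suc (x * d) → 2 ^ b ≡ 1
    small zero eq = eq
    small (suc x) eq = ⊥-elim (<-irrefl eq (≤-trans 2^b<q (s≤s (m≤m+n d (x * d)))))
  ... | yes a≤b with x
  ...   | zero = 0 , eq
  ...   | suc x₁ with rec {b ∸ suc a} (∸-monoʳ-< {b} (s≤s z≤n) a≤b) y q≡ eq'
    where
    v = 2 ^ (b ∸ suc a)
    split : 2 ^ b ≡ v * suc d
    split = ≡-trans (cong (2 ^_) (sym (m∸n+n≡m a≤b)))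
             (≡-trans (^-distribˡ-+-* 2 (b ∸ suc a) (suc a)) (cong (v *_) (sym q≡)))
    -- Cancelling `v * d` in `v + v * d = 1 + x * d` leaves v congruent to 1 modulo d with quotient
    -- x - v, so the induction hypothesis applies to v.
    y = suc x₁ ∸ v
    v≤x : v ≤ suc x₁
    v≤x = ≮⇒≥ λ x<v → <-irrefl (≡-trans (sym eq) split) (big x<v)
      where
      big : suc x₁ < v → suc (suc x₁ * d) < v * suc d
      big x<v = begin-strict
        suc (suc x₁ * d)  <⟨ s≤s (s≤s (m≤n+m _ x₁)) ⟩
        suc (suc x₁) + suc x₁ * d     ≤⟨ +-mono-≤ x<v (*-monoˡ-≤ d (<⇒≤ x<v)) ⟩
        v + v * d         ≡⟨ sym (*-suc v d) ⟩
        v * suc d         ∎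
        where open ≤-Reasoning
    eq' : v ≡ suc (y * d)
    eq' = +-cancelʳ-≡ (v * d) v (suc (y * d)) (begin
      v + v * d           ≡⟨ sym (*-suc v d) ⟩
      v * suc d           ≡⟨ sym split ⟩
      2 ^ b               ≡⟨ eq ⟩
      suc (suc x₁ * d)    ≡⟨ cong (λ k → suc (k * d)) (sym (m∸n+n≡m v≤x)) ⟩
      suc ((y + v) * d)   ≡⟨ cong suc (*-distribʳ-+ d y v) ⟩
      suc (y * d) + v * d ∎)
      where open ≡-Reasoning
  ...     | j , eqj = suc j , (begin
      2 ^ b                       ≡⟨ cong (2 ^_) (sym (m∸n+n≡m a≤b)) ⟩
      2 ^ (b ∸ suc a + suc a)     ≡⟨ ^-distribˡ-+-* 2 (b ∸ suc a) (suc a) ⟩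
      2 ^ (b ∸ suc a) * 2 ^ suc a ≡⟨ cong₂ _*_ eqj (sym q≡) ⟩
      suc d ^ j * suc d           ≡⟨ *-comm (suc d ^ j) (suc d) ⟩
      suc d ^ suc j               ∎)
      where open ≡-Reasoning

digit-unique : ∀ d j m r s → j < d → m < d → j + r * d ≡ m + s * d → j ≡ m
digit-unique d j m zero zero j<d m<d eq = ≡-trans (sym (+-identityʳ j)) (≡-trans eq (+-identityʳ m))
digit-unique d j m zero (suc s) j<d m<d eq = ⊥-elim (<-irrefl eq
  (≤-trans (s≤s (≤-reflexive (+-identityʳ j))) (≤-trans j<d (≤-trans (m≤m+n d (s * d)) (m≤n+m _ m)))))
digit-unique d j m (suc r) zero j<d m<d eq = ⊥-elim (<-irrefl (sym eq)
  (≤-trans (s≤s (≤-reflexive (+-identityʳ m))) (≤-trans m<d (≤-trans (m≤m+n d (r * d)) (m≤n+m _ j)))))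
digit-unique d j m (suc r) (suc s) j<d m<d eq = digit-unique d j m r s j<d m<d
  (+-cancelʳ-≡ d _ _ (≡-trans (lem j r d) (≡-trans eq (sym (lem m s d)))))
  where
  lem : ∀ j r d → j + r * d + d ≡ j + suc r * d
  lem = solve-∀

-- After subtracting 1 and dividing by d, the expansion of `suc d ^ j` has j as its last digit in
-- base d.
exponent-unique : ∀ d j m r .{{_ : NonZero d}} → j < d → m < d →
                  suc d ^ j ≡ suc (m * d + r * (d * d)) → j ≡ m
exponent-unique d j m r j<d m<d eq with power-expansion d j
... | r' , eq' = digit-unique d j m r' r j<d m<d (*-cancelʳ-≡ _ _ d
      (≡-trans (sym (lem j r' d)) (≡-trans (suc-injective (≡-trans (sym eq') eq)) (lem m r d))))
  where
  lem : ∀ j r d → j * d + r * (d * d) ≡ (j + r * d) * d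
  lem = solve-∀

-- Modulo d, the number must be a power of `suc d`; modulo `d * d`, its exponent agrees with m up to
-- multiples of d. The bound on the possible exponents removes this ambiguity.
congruence-pins-power : ∀ a d b m r → suc d ≡ 2 ^ suc a → 2 ^ b ≡ suc (m * d + r * (d * d)) →
                        m < d → (∀ j → 2 ^ b ≡ suc d ^ j → j < d) → 2 ^ b ≡ suc d ^ m
congruence-pins-power a d b m r q≡ eq m<d bound
  with root-of-power a d b (m + r * d) q≡ (≡-trans eq (cong suc (lem m r d)))
  where
  lem : ∀ j r d → j * d + r * (d * d) ≡ (j + r * d) * d
  lem = solve-∀
... | j , eqj = ≡-trans eqj (cong (suc d ^_)
      (exponent-unique d j m r {{>-nonZero (≤-trans (s≤s z≤n) m<d)}} (bound j eqj) m<d (≡-trans (sym eqj) eq)))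

-- Satisfied by the code c of the self-naming term of the liar sentence, where V = 2^N (see codeEquation).
CodeEquation : ℕ → ℕ → Set
CodeEquation V c = c * 511 + 272 + V ^ 9 * 20 ≡ V ^ 12 * 1314

-- Says that w + 1 = 2^g for g = 8c + 5, provided u is least. With N = 2h + 1, a = 16N and q = d + 1 = V^16 = 2^a,
-- the first congruence makes u = q^g and the second one makes u = (w + 1)^a; both are linear because
-- (e + 1)^k ≡ 1 + k e mod e². The final inequality excludes exponents of w + 1 other than a.
Certificate : ℕ → ℕ → ℕ → ℕ → Set
Certificate x u w h =
  ∃ λ V → V < suc u × ∃ λ c → c < suc u × ∃ λ d → d < suc u ×
  ∃ λ r → r < suc u × ∃ λ s → s < suc u ×
  x ≡ V * suc (h * 2) ×
  ¬ HasOddFactor V ×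
  CodeEquation V c ×
  suc d ≡ V ^ 16 ×
  ¬ HasOddFactor u ×
  u ≡ suc ((c * 8 + 5) * d + r * (d * d)) ×
  ¬ HasOddFactor (suc w) ×
  u ≡ suc (suc (h * 2) * 16 * w + s * (w * w)) ×
  suc (h * 2) * 16 * (c * 8 + 5) < w

codeEquation-unique : ∀ V c c' → CodeEquation V c → CodeEquation V c' → c ≡ c'
codeEquation-unique V c c' eq eq' = *-cancelʳ-≡ c c' 511
  (+-cancelʳ-≡ 272 _ _ (+-cancelʳ-≡ (V ^ 9 * 20) _ _ (≡-trans eq (sym eq'))))

-- The equation gives `c ≤ V ^ 12 * 3`, and the spare factor `V ^ 4` absorbs the constants. Hence
-- the exponent `c * 8 + 5` is a single digit in base `V ^ 16` - 1.
codeEquation-bound : ∀ V c → 8 ≤ V → CodeEquation V c → suc (c * 8 + 5) < V ^ 16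
codeEquation-bound V c 8≤V eq = begin-strict
  suc (c * 8 + 5)             ≡⟨ lem₁ c ⟩
  c * 8 + 6                   <⟨ +-mono-≤-< (*-monoˡ-≤ 8 c≤) (*-monoˡ-≤ 7 1≤V¹²) ⟩
  V ^ 12 * 3 * 8 + V ^ 12 * 7 ≡⟨ lem₂ (V ^ 12) ⟩
  V ^ 12 * 31                 ≤⟨ *-monoʳ-≤ (V ^ 12) (≤-trans (m≤m+n 31 4065) (^-monoˡ-≤ 4 8≤V)) ⟩
  V ^ 12 * V ^ 4              ≡⟨ sym (^-distribˡ-+-* V 12 4) ⟩
  V ^ 16                      ∎
  where
  open ≤-Reasoning
  lem₁ : ∀ c → suc (c * 8 + 5) ≡ c * 8 + 6
  lem₁ = solve-∀
  lem₂ : ∀ y → y * 3 * 8 + y * 7 ≡ y * 31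
  lem₂ = solve-∀
  1≤V¹² : 1 ≤ V ^ 12
  1≤V¹² = m^n>0 V {{>-nonZero (≤-trans (s≤s z≤n) 8≤V)}} 12
  c≤ : c ≤ V ^ 12 * 3
  c≤ = *-cancelʳ-≤ c (V ^ 12 * 3) 511 (begin
    c * 511                      ≤⟨ ≤-trans (m≤m+n _ 272) (m≤m+n _ (V ^ 9 * 20)) ⟩
    c * 511 + 272 + V ^ 9 * 20   ≡⟨ eq ⟩
    V ^ 12 * 1314                ≤⟨ *-monoʳ-≤ (V ^ 12) (m≤m+n 1314 219) ⟩
    V ^ 12 * 1533                ≡⟨ sym (*-assoc (V ^ 12) 3 511) ⟩
    V ^ 12 * 3 * 511             ∎)

-- N, V, a, q are kept as variables: unfolding 2 ^ (N * 16) would be prohibitively large.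
module Pinned (h c N V a q : ℕ) (N≡ : N ≡ suc (h * 2)) (V≡ : V ≡ 2 ^ N) (a≡ : a ≡ N * 16) (q≡ : q ≡ V ^ 16)
              (1≤h : 1 ≤ h) (eqn : CodeEquation V c) (large : N * 4 ≤ c) where

  g d U w : ℕ
  g = c * 8 + 5
  d = pred q
  U = q ^ g
  w = pred (2 ^ g)

  private
    instance
      V-nonZero : NonZero V
      V-nonZero = subst NonZero (sym V≡) (m^n≢0 2 N)
      q-nonZero : NonZero q
      q-nonZero = subst NonZero (sym q≡) (m^n≢0 V 16)
      2^g-nonZero : NonZero (2 ^ g)
      2^g-nonZero = m^n≢0 2 g
      g-nonZero : NonZero g
      g-nonZero = >-nonZero (≤-trans (s≤s z≤n) (m≤n+m 5 (c * 8)))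
      a-nonZero : NonZero a
      a-nonZero = subst NonZero (sym a≡) (m*n≢0 N 16 {{subst NonZero (sym N≡) _}})

    8≤V : 8 ≤ V
    8≤V = subst (8 ≤_) (sym V≡) (^-monoʳ-≤ 2 (subst (3 ≤_) (sym N≡) (s≤s (*-monoˡ-≤ 2 1≤h))))

    1+d≡q : suc d ≡ q
    1+d≡q = suc-pred q

    q≡2^a : q ≡ 2 ^ a
    q≡2^a = ≡-trans q≡ (≡-trans (cong (_^ 16) V≡) (≡-trans (^-*-assoc 2 N 16) (cong (2 ^_) (sym a≡))))

    U≡2^ag : U ≡ 2 ^ (a * g)
    U≡2^ag = ≡-trans (cong (_^ g) q≡2^a) (^-*-assoc 2 a g)

    1+w≡2^g : suc w ≡ 2 ^ g
    1+w≡2^g = suc-pred (2 ^ g)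

    g<d : g < d
    g<d = ≤-pred (subst (suc g <_) (sym 1+d≡q) (subst (suc g <_) (sym q≡) (codeEquation-bound V c 8≤V eqn)))

    a≤d : a ≤ d
    a≤d = ≤-pred (subst (a <_) (≡-trans (sym q≡2^a) (sym 1+d≡q)) (n<2^n a))

    2a<g : a * 2 < g
    2a<g = begin-strict
      a * 2         ≡⟨ cong (_* 2) a≡ ⟩
      N * 16 * 2    ≡⟨ lem N ⟩
      N * 4 * 8     ≤⟨ *-monoˡ-≤ 8 large ⟩
      c * 8         <⟨ m<m+n (c * 8) (s≤s z≤n) ⟩
      g             ∎
      where
      open ≤-Reasoning
      lem : ∀ n → n * 16 * 2 ≡ n * 4 * 8
      lem = solve-∀

    -- Both a and g are at most d, so the product is below `q ^ 2 = 2 ^ (a * 2)`, and `a * 2 < g`.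
    ag<w : a * g < w
    ag<w = ≤-pred (begin-strict
      suc (a * g)       ≤⟨ s≤s (*-mono-≤ a≤d (<⇒≤ g<d)) ⟩
      suc (d * d)       ≤⟨ s≤s (≤-trans (m≤n+m _ d) (m≤n+m _ d)) ⟩
      suc (d + (d + d * d)) ≡⟨ lem d ⟩
      suc d ^ 2         ≡⟨ cong (_^ 2) (≡-trans 1+d≡q q≡2^a) ⟩
      (2 ^ a) ^ 2       ≡⟨ ^-*-assoc 2 a 2 ⟩
      2 ^ (a * 2)       <⟨ ^-monoʳ-< 2 (s≤s (s≤s z≤n)) 2a<g ⟩
      2 ^ g             ≡⟨ sym 1+w≡2^g ⟩
      suc w             ∎)
      where
      open ≤-Reasoning
      lem : ∀ d → suc (d + (d + d * d)) ≡ suc d * (suc d * 1)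
      lem = solve-∀

    1<q : 1 < q
    1<q = subst (1 <_) 1+d≡q (s≤s (≤-trans (s≤s z≤n) g<d))

    q≤U : q ≤ U
    q≤U = subst (_≤ U) (^-identityʳ q) (^-monoʳ-≤ q (>-nonZero⁻¹ g))

    g≤U : g ≤ U
    g≤U = ≤-trans (<⇒≤ g<d) (≤-trans (pred[n]≤n {q}) q≤U)

    coefficient≤ : ∀ k m r e → 1 ≤ e → k ≡ suc (m + r * (e * e)) → r ≤ k
    coefficient≤ k m r e 1≤e refl = ≤-trans (m≤m*n r (e * e) {{>-nonZero (*-mono-≤ 1≤e 1≤e)}})
      (≤-trans (m≤n+m _ m) (n≤1+n _))

    -- The number `2 ^ (a * g)` is both `q ^ g` and `(2 ^ g) ^ a`; this double reading ties w to g.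
    U≡W^a : U ≡ suc w ^ a
    U≡W^a = ≡-trans U≡2^ag (≡-trans (cong (2 ^_) (*-comm a g))
             (≡-trans (sym (^-*-assoc 2 g a)) (cong (_^ a) (sym 1+w≡2^g))))

  w≤U : w ≤ U
  w≤U = ≤-trans (pred[n]≤n {2 ^ g}) (subst (2 ^ g ≤_) (sym U≡2^ag) (^-monoʳ-≤ 2 (m≤n*m g a)))

  h≤U : h ≤ U
  h≤U = begin
    h            ≤⟨ m≤m*n h 2 ⟩
    h * 2        ≤⟨ n≤1+n _ ⟩
    suc (h * 2)  ≡⟨ sym N≡ ⟩
    N            ≤⟨ m≤m*n N 4 ⟩
    N * 4        ≤⟨ large ⟩
    c            ≤⟨ ≤-trans (m≤m*n c 8) (m≤m+n _ 5) ⟩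
    g            ≤⟨ g≤U ⟩
    U            ∎
    where open ≤-Reasoning

  private
    a≡' : a ≡ suc (h * 2) * 16
    a≡' = ≡-trans a≡ (cong (_* 16) N≡)

  certificate : Certificate (V * N) U w h
  certificate with power-expansion d g | power-expansion w a
  ... | r , eqr | s , eqs =
    V , s≤s (≤-trans (m≤m*n V (V ^ 15) {{m^n≢0 V 15}}) (subst (_≤ U) q≡ q≤U)) ,
    c , s≤s (≤-trans (≤-trans (m≤m*n c 8) (m≤m+n _ 5)) g≤U) ,
    d , s≤s (≤-trans (pred[n]≤n {q}) q≤U) ,
    r , s≤s (coefficient≤ U (g * d) r d (≤-trans (s≤s z≤n) g<d) U≡r) ,
    s , s≤s (coefficient≤ U (a * w) s w (≤-trans (s≤s z≤n) ag<w) U≡s) ,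
    cong (V *_) N≡ , subst (λ k → ¬ HasOddFactor k) (sym V≡) (power⇒oddFactorFree N) ,
    eqn , ≡-trans 1+d≡q q≡ ,
    subst (λ k → ¬ HasOddFactor k) (sym U≡2^ag) (power⇒oddFactorFree (a * g)) ,
    U≡r ,
    subst (λ k → ¬ HasOddFactor k) (sym 1+w≡2^g) (power⇒oddFactorFree g) ,
    ≡-trans U≡s (cong (λ k → suc (k * w + s * (w * w))) a≡') , subst (λ k → k * g < w) a≡' ag<w
    where
    U≡r : U ≡ suc (g * d + r * (d * d))
    U≡r = ≡-trans (cong (_^ g) (sym 1+d≡q)) eqr
    U≡s : U ≡ suc (a * w + s * (w * w))
    U≡s = ≡-trans U≡W^a eqs

  -- Since N is odd, `V * N` determines V and h; the code equation then gives c, and V gives d. The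
  -- first congruence forces u to be `U`, and the second one then forces `suc w'` to be `2 ^ g`.
  certificate-unique : ∀ u w' h' → u ≤ U → Certificate (V * N) u w' h' → u ≡ U × w' ≡ w × h' ≡ h
  certificate-unique u w' h' u≤U
    (V' , _ , c' , _ , d' , _ , r , _ , s , _ , x≡ , V'pow , eqn' , q'≡ , upow , u≡r , wpow , u≡s , ag<w')
    with oddFactorFree⇒power V' V'pow | oddFactorFree⇒power u upow
  ... | i , V'≡ | b , u≡ = ≡-trans u≡ u≡U ,
        suc-injective (≡-trans (proj₂ pow-w) (≡-trans (cong (2 ^_) e≡g) (sym 1+w≡2^g))) , sym (proj₂ split)
    where
    split : N ≡ i × h ≡ h'
    split = power*odd-injective N i h h'
      (≡-trans (cong₂ _*_ (sym V≡) (sym N≡)) (≡-trans x≡ (cong (_* suc (h' * 2)) V'≡)))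
    V≡V' : V' ≡ V
    V≡V' = ≡-trans V'≡ (≡-trans (cong (2 ^_) (sym (proj₁ split))) (sym V≡))
    c'≡c : c' ≡ c
    c'≡c = codeEquation-unique V c' c (subst (λ v → CodeEquation v c') V≡V' eqn') eqn
    d'≡d : d' ≡ d
    d'≡d = suc-injective (≡-trans q'≡ (≡-trans (cong (_^ 16) V≡V') (≡-trans (sym q≡) (sym 1+d≡q))))
    a'≡a : suc (h' * 2) * 16 ≡ a
    a'≡a = ≡-trans (cong (λ k → suc (k * 2) * 16) (sym (proj₂ split))) (sym a≡')
    ag<w₁ : a * g < w'
    ag<w₁ = subst (_< w') (cong₂ _*_ a'≡a (cong (λ k → k * 8 + 5) c'≡c)) ag<w'
    u≡r₁ : 2 ^ b ≡ suc (g * d + r * (d * d))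
    u≡r₁ = ≡-trans (sym u≡) (≡-trans u≡r (cong₂ (λ k e → suc ((k * 8 + 5) * e + r * (e * e))) c'≡c d'≡d))
    u≡s₁ : 2 ^ b ≡ suc (a * w' + s * (w' * w'))
    u≡s₁ = ≡-trans (sym u≡) (≡-trans u≡s (cong (λ k → suc (k * w' + s * (w' * w'))) a'≡a))
    2^b≡q^g : 2 ^ b ≡ suc d ^ g
    2^b≡q^g = congruence-pins-power (pred a) d b g r
                (≡-trans 1+d≡q (≡-trans q≡2^a (cong (2 ^_) (sym (suc-pred a))))) u≡r₁ g<d bound
      where
      -- This uses `u ≤ U`: an exponent above g would make u exceed `U`.
      bound : ∀ j → 2 ^ b ≡ suc d ^ j → j < d
      bound j eq = ≤-<-trans (≮⇒≥ λ g<j → <-irrefl refl (begin-strict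
        suc d ^ g   <⟨ ^-monoʳ-< (suc d) (subst (1 <_) (sym 1+d≡q) 1<q) g<j ⟩
        suc d ^ j   ≡⟨ sym eq ⟩
        2 ^ b       ≡⟨ sym u≡ ⟩
        u           ≤⟨ u≤U ⟩
        U           ≡⟨ cong (_^ g) (sym 1+d≡q) ⟩
        suc d ^ g   ∎)) g<d
        where open ≤-Reasoning
    u≡U : 2 ^ b ≡ U
    u≡U = ≡-trans 2^b≡q^g (cong (_^ g) 1+d≡q)
    pow-w : ∃ λ e → suc w' ≡ 2 ^ e
    pow-w = oddFactorFree⇒power (suc w') wpow
    exponent≡ : ∀ e j → suc w' ≡ 2 ^ e → 2 ^ b ≡ suc w' ^ j → e * j ≡ a * g
    exponent≡ e j w≡ eq = 2^-injective (e * j) (a * g) (≡-trans (sym (^-*-assoc 2 e j))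
      (≡-trans (cong (_^ j) (sym w≡)) (≡-trans (sym eq) (≡-trans u≡U U≡2^ag))))
    positive : ∀ e → suc w' ≡ 2 ^ e → ∃ λ e' → e ≡ suc e'
    positive zero w≡ = ⊥-elim (n≮0 (subst (a * g <_) (suc-injective w≡) ag<w₁))
    positive (suc e) _ = e , refl
    e≡g : proj₁ pow-w ≡ g
    e≡g with pow-w
    ... | e , w≡ with positive e w≡
    -- With `suc w' = 2 ^ e`, the second congruence gives `u = suc w' ^ a`, so `e * a = a * g`. Any
    -- other exponent j would satisfy `e * j = a * g`, hence stays below w'.
    ... | e' , refl = *-cancelʳ-≡ (suc e') g a (≡-trans
          (exponent≡ (suc e') a w≡ (congruence-pins-power e' w' b a s w≡ u≡s₁
            (≤-<-trans (m≤m*n a g) ag<w₁)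
            λ j eq → ≤-<-trans (subst (j ≤_) (exponent≡ (suc e') j w≡ eq) (m≤n*m j (suc e'))) ag<w₁))
          (*-comm a g))

-- Substitution

substT-ext : ∀ {n n'} {σ τ : Fin n → Tm n'} → (∀ i → σ i ≡ τ i) → ∀ t → substT σ t ≡ substT τ t
substT-ext eq (var i) = eq i
substT-ext eq zer = refl
substT-ext eq (S t) = cong S (substT-ext eq t)
substT-ext eq (t ⊕ u) = cong₂ _⊕_ (substT-ext eq t) (substT-ext eq u)
substT-ext eq (t ⊗ u) = cong₂ _⊗_ (substT-ext eq t) (substT-ext eq u)

substT-id : ∀ {n} {σ : Fin n → Tm n} → (∀ i → σ i ≡ var i) → ∀ t → substT σ t ≡ t
substT-id eq (var i) = eq i
substT-id eq zer = refl
substT-id eq (S t) = cong S (substT-id eq t)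
substT-id eq (t ⊕ u) = cong₂ _⊕_ (substT-id eq t) (substT-id eq u)
substT-id eq (t ⊗ u) = cong₂ _⊗_ (substT-id eq t) (substT-id eq u)

substT-renT : ∀ {n n' n''} (σ : Fin n' → Tm n'') (ρ : Fin n → Fin n') t →
              substT σ (renT ρ t) ≡ substT (σ ∘ ρ) t
substT-renT σ ρ (var i) = refl
substT-renT σ ρ zer = refl
substT-renT σ ρ (S t) = cong S (substT-renT σ ρ t)
substT-renT σ ρ (t ⊕ u) = cong₂ _⊕_ (substT-renT σ ρ t) (substT-renT σ ρ u)
substT-renT σ ρ (t ⊗ u) = cong₂ _⊗_ (substT-renT σ ρ t) (substT-renT σ ρ u)

renT-substT : ∀ {n n' n''} (ρ : Fin n' → Fin n'') (σ : Fin n → Tm n') t →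
              renT ρ (substT σ t) ≡ substT (renT ρ ∘ σ) t
renT-substT ρ σ (var i) = refl
renT-substT ρ σ zer = refl
renT-substT ρ σ (S t) = cong S (renT-substT ρ σ t)
renT-substT ρ σ (t ⊕ u) = cong₂ _⊕_ (renT-substT ρ σ t) (renT-substT ρ σ u)
renT-substT ρ σ (t ⊗ u) = cong₂ _⊗_ (renT-substT ρ σ t) (renT-substT ρ σ u)

substT-substT : ∀ {n n' n''} (τ : Fin n' → Tm n'') (σ : Fin n → Tm n') t →
                substT τ (substT σ t) ≡ substT (substT τ ∘ σ) t
substT-substT τ σ (var i) = refl
substT-substT τ σ zer = refl
substT-substT τ σ (S t) = cong S (substT-substT τ σ t)
substT-substT τ σ (t ⊕ u) = cong₂ _⊕_ (substT-substT τ σ t) (substT-substT τ σ u)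
substT-substT τ σ (t ⊗ u) = cong₂ _⊗_ (substT-substT τ σ t) (substT-substT τ σ u)

substT-var-suc : ∀ {n} (t : Tm n) → substT (var ∘ suc) t ≡ renT suc t
substT-var-suc t = ≡-trans (sym (substT-renT var suc t)) (substT-id (λ _ → refl) (renT suc t))

sub0-renT : ∀ {n} (s t : Tm n) → substT (sub0 s) (renT suc t) ≡ t
sub0-renT s t = ≡-trans (substT-renT (sub0 s) suc t) (substT-id (λ _ → refl) t)

substT-num : ∀ {n n'} (σ : Fin n → Tm n') k → substT σ (num k) ≡ num k
substT-num σ zero = refl
substT-num σ (suc k) = cong S (substT-num σ k)

renT-num : ∀ {n n'} (ρ : Fin n → Fin n') k → renT ρ (num k) ≡ num k
renT-num ρ zero = refl
renT-num ρ (suc k) = cong S (renT-num ρ k)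

liftS-ext : ∀ {n n'} {σ τ : Fin n → Tm n'} → (∀ i → σ i ≡ τ i) → ∀ i → liftS σ i ≡ liftS τ i
liftS-ext eq zero = refl
liftS-ext eq (suc i) = cong (renT suc) (eq i)

liftS-id : ∀ {n} {σ : Fin n → Tm n} → (∀ i → σ i ≡ var i) → ∀ i → liftS σ i ≡ var i
liftS-id eq zero = refl
liftS-id eq (suc i) = cong (renT suc) (eq i)

liftS-substT : ∀ {n n' n''} (τ : Fin n' → Tm n'') (σ : Fin n → Tm n') i →
               substT (liftS τ) (liftS σ i) ≡ liftS (substT τ ∘ σ) i
liftS-substT τ σ zero = refl
liftS-substT τ σ (suc i) = ≡-trans (substT-renT (liftS τ) suc (σ i)) (sym (renT-substT suc τ (σ i)))

substF-ext : ∀ {n n' m} {σ τ : Fin n → Tm n'} → (∀ i → σ i ≡ τ i) → (φ : Fm n m) → substF σ φ ≡ substF τ φ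
substF-ext eq (s ≐ t) = cong₂ _≐_ (substT-ext eq s) (substT-ext eq t)
substF-ext eq (s <' t) = cong₂ _<'_ (substT-ext eq s) (substT-ext eq t)
substF-ext eq (a ≈ᵢ b) = refl
substF-ext eq (a ≺ b) = refl
substF-ext eq (T a t) = cong (T a) (substT-ext eq t)
substF-ext eq ⊥' = refl
substF-ext eq (φ ⇒ ψ) = cong₂ _⇒_ (substF-ext eq φ) (substF-ext eq ψ)
substF-ext eq (∀ₙ φ) = cong ∀ₙ (substF-ext (liftS-ext eq) φ)
substF-ext eq (∀ᵢ φ) = cong ∀ᵢ (substF-ext eq φ)

substF-id : ∀ {n m} {σ : Fin n → Tm n} → (∀ i → σ i ≡ var i) → (φ : Fm n m) → substF σ φ ≡ φ
substF-id eq (s ≐ t) = cong₂ _≐_ (substT-id eq s) (substT-id eq t)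
substF-id eq (s <' t) = cong₂ _<'_ (substT-id eq s) (substT-id eq t)
substF-id eq (a ≈ᵢ b) = refl
substF-id eq (a ≺ b) = refl
substF-id eq (T a t) = cong (T a) (substT-id eq t)
substF-id eq ⊥' = refl
substF-id eq (φ ⇒ ψ) = cong₂ _⇒_ (substF-id eq φ) (substF-id eq ψ)
substF-id eq (∀ₙ φ) = cong ∀ₙ (substF-id (liftS-id eq) φ)
substF-id eq (∀ᵢ φ) = cong ∀ᵢ (substF-id eq φ)

substF-substF : ∀ {n n' n'' m} (τ : Fin n' → Tm n'') (σ : Fin n → Tm n') (φ : Fm n m) →
                substF τ (substF σ φ) ≡ substF (substT τ ∘ σ) φ
substF-substF τ σ (s ≐ t) = cong₂ _≐_ (substT-substT τ σ s) (substT-substT τ σ t)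
substF-substF τ σ (s <' t) = cong₂ _<'_ (substT-substT τ σ s) (substT-substT τ σ t)
substF-substF τ σ (a ≈ᵢ b) = refl
substF-substF τ σ (a ≺ b) = refl
substF-substF τ σ (T a t) = cong (T a) (substT-substT τ σ t)
substF-substF τ σ ⊥' = refl
substF-substF τ σ (φ ⇒ ψ) = cong₂ _⇒_ (substF-substF τ σ φ) (substF-substF τ σ ψ)
substF-substF τ σ (∀ₙ φ) = cong ∀ₙ (≡-trans (substF-substF (liftS τ) (liftS σ) φ) (substF-ext (liftS-substT τ σ) φ))
substF-substF τ σ (∀ᵢ φ) = cong ∀ᵢ (substF-substF τ σ φ)

infixr 5 _∷ₛ_

_∷ₛ_ : ∀ {n} {A : Set} → A → (Fin n → A) → Fin (suc n) → A
(x ∷ₛ σ) zero = x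
(x ∷ₛ σ) (suc i) = σ i

substF-sub0-liftS : ∀ {n n' m} (t : Tm n') (σ : Fin n → Tm n') (φ : Fm (suc n) m) →
                    substF (sub0 t) (substF (liftS σ) φ) ≡ substF (t ∷ₛ σ) φ
substF-sub0-liftS t σ φ = ≡-trans (substF-substF (sub0 t) (liftS σ) φ)
  (substF-ext (λ { zero → refl ; (suc i) → sub0-renT t (σ i) }) φ)

_[_≔_] : ∀ {n} {A : Set} → (Fin n → A) → Fin n → A → Fin n → A
(σ [ zero ≔ t ]) zero = t
(σ [ zero ≔ t ]) (suc j) = σ (suc j)
(σ [ suc i ≔ t ]) zero = σ zero
(σ [ suc i ≔ t ]) (suc j) = ((σ ∘ suc) [ i ≔ t ]) j

≔-self : ∀ {n} {A : Set} (σ : Fin n → A) i j → (σ [ i ≔ σ i ]) j ≡ σ j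
≔-self σ zero zero = refl
≔-self σ zero (suc j) = refl
≔-self σ (suc i) zero = refl
≔-self σ (suc i) (suc j) = ≔-self (σ ∘ suc) i j

sub0-≔ : ∀ {n n'} (s : Tm n') (σ : Fin n → Tm n') i j →
         substT (sub0 s) (((renT suc ∘ σ) [ i ≔ var zero ]) j) ≡ (σ [ i ≔ s ]) j
sub0-≔ s σ zero zero = refl
sub0-≔ s σ zero (suc j) = sub0-renT s (σ (suc j))
sub0-≔ s σ (suc i) zero = sub0-renT s (σ zero)
sub0-≔ s σ (suc i) (suc j) = sub0-≔ s (σ ∘ suc) i j

-- Bounded formulas

evT : ∀ {n} → (Fin n → ℕ) → Tm n → ℕ
evT ρ (var i) = ρ i
evT ρ zer = 0
evT ρ (S t) = suc (evT ρ t)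
evT ρ (t ⊕ u) = evT ρ t + evT ρ u
evT ρ (t ⊗ u) = evT ρ t * evT ρ u

evT-num : ∀ {n} (ρ : Fin n → ℕ) k → evT ρ (num k) ≡ k
evT-num ρ zero = refl
evT-num ρ (suc k) = cong suc (evT-num ρ k)

-- A separate syntax, because these formulas mention no index: renaming of indices and
-- relativisation leave them fixed, and their truth is decidable.
data Bounded (n : ℕ) : Set where
  eqB ltB : Tm n → Tm n → Bounded n
  negB   : Bounded n → Bounded n
  andB   : Bounded n → Bounded n → Bounded n
  exB    : Tm n → Bounded (suc n) → Bounded n

⌊_⌋ : ∀ {n m} → Bounded n → Fm n m
⌊ eqB s t ⌋ = s ≐ t
⌊ ltB s t ⌋ = s <' t
⌊ negB φ ⌋ = ¬' ⌊ φ ⌋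
⌊ andB φ ψ ⌋ = ⌊ φ ⌋ ∧' ⌊ ψ ⌋
⌊ exB t φ ⌋ = ¬' (∀ₙ ((var zero <' renT suc t) ⇒ ¬' ⌊ φ ⌋))

Holds : ∀ {n} → (Fin n → ℕ) → Bounded n → Set
Holds ρ (eqB s t) = evT ρ s ≡ evT ρ t
Holds ρ (ltB s t) = evT ρ s < evT ρ t
Holds ρ (negB φ) = ¬ Holds ρ φ
Holds ρ (andB φ ψ) = Holds ρ φ × Holds ρ ψ
Holds ρ (exB t φ) = ∃ λ k → k < evT ρ t × Holds (k ∷ₛ ρ) φ

holds? : ∀ {n} (ρ : Fin n → ℕ) φ → Dec (Holds ρ φ)
holds? ρ (eqB s t) = evT ρ s ≟ evT ρ t
holds? ρ (ltB s t) = evT ρ s <? evT ρ t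
holds? ρ (negB φ) = ¬? (holds? ρ φ)
holds? ρ (andB φ ψ) = holds? ρ φ ×-dec holds? ρ ψ
holds? ρ (exB t φ) = anyUpTo? (λ k → holds? (k ∷ₛ ρ) φ) (evT ρ t)

renI-⌊⌋ : ∀ {n n' m m'} (f : Fin m → Fin m') (σ : Fin n → Tm n') φ →
          renI f (substF σ ⌊ φ ⌋) ≡ substF σ ⌊ φ ⌋
renI-⌊⌋ f σ (eqB s t) = refl
renI-⌊⌋ f σ (ltB s t) = refl
renI-⌊⌋ f σ (negB φ) = cong ¬' (renI-⌊⌋ f σ φ)
renI-⌊⌋ f σ (andB φ ψ) = cong₂ _∧'_ (renI-⌊⌋ f σ φ) (renI-⌊⌋ f σ ψ)
renI-⌊⌋ f σ (exB t φ) = cong (λ χ → ¬' (∀ₙ (_ ⇒ ¬' χ))) (renI-⌊⌋ f (liftS σ) φ)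

rel-⌊⌋ : ∀ {n n' m} (a : Fin m) (σ : Fin n → Tm n') φ → rel a (substF σ ⌊ φ ⌋) ≡ substF σ ⌊ φ ⌋
rel-⌊⌋ a σ (eqB s t) = refl
rel-⌊⌋ a σ (ltB s t) = refl
rel-⌊⌋ a σ (negB φ) = cong ¬' (rel-⌊⌋ a σ φ)
rel-⌊⌋ a σ (andB φ ψ) = cong₂ _∧'_ (rel-⌊⌋ a σ φ) (rel-⌊⌋ a σ ψ)
rel-⌊⌋ a σ (exB t φ) = cong (λ χ → ¬' (∀ₙ (_ ⇒ ¬' χ))) (rel-⌊⌋ a (liftS σ) φ)

-- Derivations in Robinson arithmetic

weaken : ∀ {Ax n m Γ Δ} {φ : Fm n m} → Γ ⊆ Δ → Prf Ax n m Γ φ → Prf Ax n m Δ φ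
weaken sub (ax p) = ax p
weaken sub (hyp x) = hyp (sub x)
weaken sub (⇒I p) = ⇒I (weaken (∷⁺ʳ _ sub) p)
weaken sub (⇒E p q) = ⇒E (weaken sub p) (weaken sub q)
weaken sub (dne p) = dne (weaken sub p)
weaken sub (∀ₙI p) = ∀ₙI (weaken (map⁺ wkN sub) p)
weaken sub (∀ₙE p t) = ∀ₙE (weaken sub p) t
weaken sub (∀ᵢI p) = ∀ᵢI (weaken (map⁺ wkI sub) p)
weaken sub (∀ᵢE p b) = ∀ᵢE (weaken sub p) b
weaken sub (reflₙ t) = reflₙ t
weaken sub (reflᵢ b) = reflᵢ b
weaken sub (substₙ φ p q) = substₙ φ (weaken sub p) (weaken sub q)
weaken sub (substᵢ φ p q) = substᵢ φ (weaken sub p) (weaken sub q)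

module Logic (Ax : Theory) where

  infix 3 _⊩_

  _⊩_ : ∀ {n m} → List (Fm n m) → Fm n m → Set
  _⊩_ {n} {m} Γ φ = Prf Ax n m Γ φ

  cast : ∀ {n m Γ} {φ ψ : Fm n m} → φ ≡ ψ → Γ ⊩ φ → Γ ⊩ ψ
  cast refl p = p

  wk : ∀ {n m Γ} {φ ψ : Fm n m} → Γ ⊩ φ → ψ ∷ Γ ⊩ φ
  wk = weaken there

  hyp₀ : ∀ {n m Γ} {φ : Fm n m} → φ ∷ Γ ⊩ φ
  hyp₀ = hyp (here refl)

  hyp₁ : ∀ {n m Γ} {φ ψ : Fm n m} → ψ ∷ φ ∷ Γ ⊩ φ
  hyp₁ = hyp (there (here refl))

  hyp₂ : ∀ {n m Γ} {φ ψ χ : Fm n m} → χ ∷ ψ ∷ φ ∷ Γ ⊩ φ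
  hyp₂ = hyp (there (there (here refl)))

  absurd : ∀ {n m Γ} {φ : Fm n m} → Γ ⊩ ⊥' → Γ ⊩ φ
  absurd p = dne (⇒I (wk p))

  cases : ∀ {n m Γ} (φ : Fm n m) {χ} → φ ∷ Γ ⊩ χ → ¬' φ ∷ Γ ⊩ χ → Γ ⊩ χ
  cases φ p q = dne (⇒I (⇒E hyp₀ (⇒E (wk (⇒I q)) (⇒I (⇒E hyp₁ (weaken (∷⁺ʳ _ there) p))))))

  ¬¬I : ∀ {n m Γ} {φ : Fm n m} → Γ ⊩ φ → Γ ⊩ ¬' (¬' φ)
  ¬¬I p = ⇒I (⇒E hyp₀ (wk p))

  ∧I : ∀ {n m Γ} {φ ψ : Fm n m} → Γ ⊩ φ → Γ ⊩ ψ → Γ ⊩ φ ∧' ψ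
  ∧I p q = ⇒I (⇒E (⇒E hyp₀ (wk p)) (wk q))

  ∧E₁ : ∀ {n m Γ} {φ ψ : Fm n m} → Γ ⊩ φ ∧' ψ → Γ ⊩ φ
  ∧E₁ p = dne (⇒I (⇒E (wk p) (⇒I (absurd (⇒E hyp₁ hyp₀)))))

  ∧E₂ : ∀ {n m Γ} {φ ψ : Fm n m} → Γ ⊩ φ ∧' ψ → Γ ⊩ ψ
  ∧E₂ p = dne (⇒I (⇒E (wk p) (⇒I hyp₁)))

  ∃ₙE : ∀ {n m Γ} {φ : Fm (suc n) m} {χ} → Γ ⊩ ∃ₙ φ → φ ∷ map wkN Γ ⊩ wkN χ → Γ ⊩ χ
  ∃ₙE p q = dne (⇒I (⇒E (wk p) (∀ₙI (⇒I (⇒E hyp₁ (weaken (∷⁺ʳ _ there) q))))))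

  ∃ₙI : ∀ {n m Γ} {φ : Fm (suc n) m} (t : Tm n) → Γ ⊩ φ [ t ]ₙ → Γ ⊩ ∃ₙ φ
  ∃ₙI t p = ⇒I (⇒E (∀ₙE hyp₀ t) (wk p))

  ∀ₙE-sub : ∀ {n n' m Γ} {σ : Fin n → Tm n'} (φ : Fm (suc n) m) →
            Γ ⊩ substF σ (∀ₙ φ) → (t : Tm n') → Γ ⊩ substF (t ∷ₛ σ) φ
  ∀ₙE-sub φ p t = cast (substF-sub0-liftS t _ φ) (∀ₙE p t)

  -- Leibniz's law at one entry of a simultaneous substitution; `θ` puts a fresh variable at i and
  -- keeps the other entries.
  replace : ∀ {n n' m Γ t} (φ : Fm n m) (σ : Fin n → Tm n') i →
            Γ ⊩ σ i ≐ t → Γ ⊩ substF σ φ → Γ ⊩ substF (σ [ i ≔ t ]) φ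
  replace {t = t} φ σ i p q = cast (unfold t) (substₙ (substF θ φ) p
      (cast (sym (≡-trans (unfold (σ i)) (substF-ext (≔-self σ i) φ))) q))
    where
    θ = (renT suc ∘ σ) [ i ≔ var zero ]
    unfold : ∀ s → substF (sub0 s) (substF θ φ) ≡ substF (σ [ i ≔ s ]) φ
    unfold s = ≡-trans (substF-substF (sub0 s) θ φ) (substF-ext (sub0-≔ s σ i) φ)

  ≐-sym : ∀ {n m} {Γ : List (Fm n m)} {s t} → Γ ⊩ s ≐ t → Γ ⊩ t ≐ s
  ≐-sym {s = s} {t} p = cast (cong (t ≐_) (sub0-renT t s))
    (substₙ (var zero ≐ renT suc s) p (cast (cong (s ≐_) (sym (sub0-renT s s))) (reflₙ s)))

  ≐-trans : ∀ {n m} {Γ : List (Fm n m)} {s t u} → Γ ⊩ s ≐ t → Γ ⊩ t ≐ u → Γ ⊩ s ≐ u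
  ≐-trans {s = s} {t} {u} p q = cast (cong (_≐ u) (sub0-renT u s))
    (substₙ (renT suc s ≐ var zero) q (cast (cong (_≐ t) (sym (sub0-renT t s))) p))

  ≐-cong : ∀ {n m} {Γ : List (Fm n m)} {s t} (f : Tm (suc n)) →
           Γ ⊩ s ≐ t → Γ ⊩ substT (sub0 s) f ≐ substT (sub0 t) f
  ≐-cong {s = s} {t} f p = cast (cong (_≐ substT (sub0 t) f) (sub0-renT t fs))
      (substₙ (renT suc fs ≐ f) p (cast (cong (_≐ fs) (sym (sub0-renT s fs))) (reflₙ fs)))
    where
    fs = substT (sub0 s) f

  S-cong : ∀ {n m} {Γ : List (Fm n m)} {s t} → Γ ⊩ s ≐ t → Γ ⊩ S s ≐ S t
  S-cong = ≐-cong (S (var zero))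

  ⊕-cong : ∀ {n m} {Γ : List (Fm n m)} {s s' t t'} → Γ ⊩ s ≐ s' → Γ ⊩ t ≐ t' → Γ ⊩ s ⊕ t ≐ s' ⊕ t'
  ⊕-cong {s = s} {s'} {t} {t'} p q = ≐-trans
    (cast (cong₂ (λ x y → s ⊕ x ≐ s' ⊕ y) (sub0-renT s t) (sub0-renT s' t)) (≐-cong (var zero ⊕ renT suc t) p))
    (cast (cong₂ (λ x y → x ⊕ t ≐ y ⊕ t') (sub0-renT t s') (sub0-renT t' s')) (≐-cong (renT suc s' ⊕ var zero) q))

  ⊗-cong : ∀ {n m} {Γ : List (Fm n m)} {s s' t t'} → Γ ⊩ s ≐ s' → Γ ⊩ t ≐ t' → Γ ⊩ s ⊗ t ≐ s' ⊗ t'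
  ⊗-cong {s = s} {s'} {t} {t'} p q = ≐-trans
    (cast (cong₂ (λ x y → s ⊗ x ≐ s' ⊗ y) (sub0-renT s t) (sub0-renT s' t)) (≐-cong (var zero ⊗ renT suc t) p))
    (cast (cong₂ (λ x y → x ⊗ t ≐ y ⊗ t') (sub0-renT t s') (sub0-renT t' s')) (≐-cong (renT suc s' ⊗ var zero) q))

  <-congʳ : ∀ {n m} {Γ : List (Fm n m)} {s t t'} → Γ ⊩ t ≐ t' → Γ ⊩ s <' t → Γ ⊩ s <' t'
  <-congʳ {s = s} {t} {t'} p q = cast (cong (_<' t') (sub0-renT t' s))
    (substₙ (renT suc s <' var zero) p (cast (cong (_<' t) (sym (sub0-renT t s))) q))

  T-cong : ∀ {n m} {Γ : List (Fm n m)} {a s t} → Γ ⊩ s ≐ t → Γ ⊩ T a s → Γ ⊩ T a t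
  T-cong {a = a} = substₙ (T a (var zero))

  -- The disjunction of `x ≐ num j` over all j < k, each "or" being an implication from the negated
  -- disjunct.
  one-of-first : ∀ {n m} → ℕ → Tm n → Fm n m
  one-of-first zero x = ⊥'
  one-of-first (suc k) x = ¬' (x ≐ num k) ⇒ one-of-first k x

  substF-one-of-first : ∀ {n n' m} (σ : Fin n → Tm n') k x →
                        substF {m = m} σ (one-of-first k x) ≡ one-of-first k (substT σ x)
  substF-one-of-first σ zero x = refl
  substF-one-of-first σ (suc k) x = cong₂ (λ s φ → ¬' (substT σ x ≐ s) ⇒ φ) (substT-num σ k) (substF-one-of-first σ k x)

  wkN-one-of-first : ∀ {n m} k (x : Tm n) → wkN {m = m} (one-of-first k x) ≡ one-of-first k (renT suc x)
  wkN-one-of-first k x = ≡-trans (substF-one-of-first _ k x) (cong (one-of-first k) (substT-var-suc x))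

  one-of-first-I : ∀ {n m} {Γ : List (Fm n m)} {x} k j → j < k → Γ ⊩ x ≐ num j → Γ ⊩ one-of-first k x
  one-of-first-I (suc k) j j<k p with j ≟ k
  ... | yes refl = ⇒I (absurd (⇒E hyp₀ (wk p)))
  ... | no j≢k = ⇒I (wk (one-of-first-I k j (≤∧≢⇒< (≤-pred j<k) j≢k) p))

  one-of-first-E : ∀ {n m} {Γ : List (Fm n m)} {x χ} k → Γ ⊩ one-of-first k x →
                   (∀ j → j < k → (x ≐ num j) ∷ Γ ⊩ χ) → Γ ⊩ χ
  one-of-first-E zero p f = absurd p
  one-of-first-E {x = x} (suc k) p f = cases (x ≐ num k) (f k ≤-refl)
    (one-of-first-E k (⇒E (wk p) hyp₀) (λ j j<k → weaken (∷⁺ʳ _ there) (f j (m≤n⇒m≤1+n j<k))))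

  one-of-first-suc : ∀ {n m} {Γ : List (Fm n m)} {x y} k → Γ ⊩ x ≐ S y →
                     Γ ⊩ one-of-first k y → Γ ⊩ one-of-first (suc k) x
  one-of-first-suc k p q = one-of-first-E k q
    (λ j j<k → one-of-first-I (suc k) (suc j) (s≤s j<k) (≐-trans (wk p) (S-cong hyp₀)))

module Robinson (Ax : Theory) (itb : ∀ {φ} → ITB φ → Ax φ) where

  open Logic Ax public

  S≢zer : ∀ {n m} {Γ : List (Fm n m)} {t} → Γ ⊩ S t ≐ zer → Γ ⊩ ⊥'
  S≢zer {t = t} p = ⇒E (∀ₙE (ax (itb q1)) t) p

  S-injective : ∀ {n m} {Γ : List (Fm n m)} {s t} → Γ ⊩ S s ≐ S t → Γ ⊩ s ≐ t
  S-injective {s = s} {t} p = cast (cong (_≐ t) (sub0-renT t s))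
    (⇒E (∀ₙE (∀ₙE (ax (itb q2)) s) t) (cast (cong (λ x → S x ≐ S t) (sym (sub0-renT t s))) p))

  predecessor : ∀ {n m} {Γ : List (Fm n m)} {t} → Γ ⊩ ¬' (t ≐ zer) → Γ ⊩ ∃ₙ (renT suc t ≐ S (var zero))
  predecessor {t = t} p = ⇒E (∀ₙE (ax (itb q3)) t) p

  ⊕-zer : ∀ {n m} {Γ : List (Fm n m)} t → Γ ⊩ t ⊕ zer ≐ t
  ⊕-zer t = ∀ₙE (ax (itb q4)) t

  ⊕-S : ∀ {n m} {Γ : List (Fm n m)} s t → Γ ⊩ s ⊕ S t ≐ S (s ⊕ t)
  ⊕-S s t = cast (cong (λ x → x ⊕ S t ≐ S (x ⊕ t)) (sub0-renT t s)) (∀ₙE (∀ₙE (ax (itb q5)) s) t)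

  ⊗-zer : ∀ {n m} {Γ : List (Fm n m)} t → Γ ⊩ t ⊗ zer ≐ zer
  ⊗-zer t = ∀ₙE (ax (itb q6)) t

  ⊗-S : ∀ {n m} {Γ : List (Fm n m)} s t → Γ ⊩ s ⊗ S t ≐ (s ⊗ t) ⊕ s
  ⊗-S s t = cast (cong (λ x → x ⊗ S t ≐ (x ⊗ t) ⊕ x) (sub0-renT t s)) (∀ₙE (∀ₙE (ax (itb q7)) s) t)

  <-definition : ∀ {n m} {Γ : List (Fm n m)} s t →
                 Γ ⊩ (s <' t) ⇔ ∃ₙ (S (var zero) ⊕ renT suc s ≐ renT suc t)
  <-definition s t = cast (cong₂ (λ x y → (x <' t) ⇔ ∃ₙ (S (var zero) ⊕ y ≐ renT suc t)) (sub0-renT t s) lem)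
    (∀ₙE (∀ₙE (ax (itb q8)) s) t)
    where
    lem : substT (liftS (sub0 t)) (renT suc (renT suc s)) ≡ renT suc s
    lem = ≡-trans (substT-renT (liftS (sub0 t)) suc (renT suc s))
           (≡-trans (sym (renT-substT suc (sub0 t) (renT suc s))) (cong (renT suc) (sub0-renT t s)))

  <-I : ∀ {n m} {Γ : List (Fm n m)} r {s t} → Γ ⊩ S r ⊕ s ≐ t → Γ ⊩ s <' t
  <-I r {s} {t} p = ⇒E (∧E₂ (<-definition s t))
    (∃ₙI r (cast (sym (cong₂ (λ x y → S r ⊕ x ≐ y) (sub0-renT r s) (sub0-renT r t))) p))

  <-E : ∀ {n m} {Γ : List (Fm n m)} {s t} → Γ ⊩ s <' t → Γ ⊩ ∃ₙ (S (var zero) ⊕ renT suc s ≐ renT suc t)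
  <-E {s = s} {t} p = ⇒E (∧E₁ (<-definition s t)) p

  num-⊕ : ∀ {n m} {Γ : List (Fm n m)} i j → Γ ⊩ num i ⊕ num j ≐ num (i + j)
  num-⊕ i zero = cast (cong (λ k → num i ⊕ zer ≐ num k) (sym (+-identityʳ i))) (⊕-zer (num i))
  num-⊕ i (suc j) = cast (cong (λ k → num i ⊕ num (suc j) ≐ num k) (sym (+-suc i j)))
    (≐-trans (⊕-S (num i) (num j)) (S-cong (num-⊕ i j)))

  num-⊗ : ∀ {n m} {Γ : List (Fm n m)} i j → Γ ⊩ num i ⊗ num j ≐ num (i * j)
  num-⊗ i zero = cast (cong (λ k → num i ⊗ zer ≐ num k) (sym (*-zeroʳ i))) (⊗-zer (num i))
  num-⊗ i (suc j) = cast (cong (λ k → num i ⊗ num (suc j) ≐ num k) (≡-trans (+-comm (i * j) i) (sym (*-suc i j))))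
    (≐-trans (⊗-S (num i) (num j)) (≐-trans (⊕-cong (num-⊗ i j) (reflₙ (num i))) (num-⊕ (i * j) i)))

  num-≢ : ∀ {n m} {Γ : List (Fm n m)} i j → i ≢ j → Γ ⊩ num i ≐ num j → Γ ⊩ ⊥'
  num-≢ zero zero i≢j p = ⊥-elim (i≢j refl)
  num-≢ zero (suc j) i≢j p = S≢zer (≐-sym p)
  num-≢ (suc i) zero i≢j p = S≢zer p
  num-≢ (suc i) (suc j) i≢j p = num-≢ i j (i≢j ∘ cong suc) (S-injective p)

  num-< : ∀ {n m} {Γ : List (Fm n m)} i j → i < j → Γ ⊩ num i <' num j
  num-< i j i<j with m≤n⇒∃[o]m+o≡n i<j
  ... | k , refl = <-I (num k) (cast (cong (λ l → S (num k) ⊕ num i ≐ num (suc l)) (+-comm k i)) (num-⊕ (suc k) i))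

  evaluate : ∀ {n n' m} {Γ : List (Fm n' m)} (σ : Fin n → Tm n') (ρ : Fin n → ℕ) →
             (∀ i → σ i ≡ num (ρ i)) → ∀ t → Γ ⊩ substT σ t ≐ num (evT ρ t)
  evaluate σ ρ eqs (var i) = cast (cong (_≐ num (ρ i)) (sym (eqs i))) (reflₙ _)
  evaluate σ ρ eqs zer = reflₙ zer
  evaluate σ ρ eqs (S t) = S-cong (evaluate σ ρ eqs t)
  evaluate σ ρ eqs (t ⊕ u) = ≐-trans (⊕-cong (evaluate σ ρ eqs t) (evaluate σ ρ eqs u)) (num-⊕ (evT ρ t) (evT ρ u))
  evaluate σ ρ eqs (t ⊗ u) = ≐-trans (⊗-cong (evaluate σ ρ eqs t) (evaluate σ ρ eqs u)) (num-⊗ (evT ρ t) (evT ρ u))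

  -- Induction on k outside the theory. If x is zero, then `Q1` excludes k = 0; if x is a successor,
  -- `Q5` moves it out of the sum and `Q2` strips one successor from k.
  below-num-step : ∀ {n m} {Γ : List (Fm n m)} k z x → Γ ⊩ (S z ⊕ x ≐ num k) ⇒ one-of-first k x
  below-num-step k z x = ⇒I (cases (x ≐ zer) (is-zero k) (∃ₙE (predecessor hyp₀) (cast (sym (wkN-one-of-first k x))
      (is-suc k (≐-trans (≐-sym (≐-trans (⊕-cong (reflₙ _) hyp₀) (⊕-S _ _)))
        (cast (cong₂ (λ y l → S z' ⊕ y ≐ l) (substT-var-suc x) (substT-num _ k)) hyp₂))))))
    where
    z' = substT (var ∘ suc) z
    is-zero : ∀ {Γ} k → (x ≐ zer) ∷ (S z ⊕ x ≐ num k) ∷ Γ ⊩ one-of-first k x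
    is-zero zero = absurd (S≢zer (≐-trans (≐-sym (⊕-zer (S z))) (≐-trans (⊕-cong (reflₙ (S z)) (≐-sym hyp₀)) hyp₁)))
    is-zero (suc k) = one-of-first-I (suc k) 0 (s≤s z≤n) hyp₀
    is-suc : ∀ {Γ} k → (renT suc x ≐ S (var zero)) ∷ Γ ⊩ S (S z' ⊕ var zero) ≐ num k →
             (renT suc x ≐ S (var zero)) ∷ Γ ⊩ one-of-first k (renT suc x)
    is-suc zero p = absurd (S≢zer p)
    is-suc (suc k) p = one-of-first-suc k hyp₀ (⇒E (below-num-step k z' (var zero)) (S-injective p))

  below-num : ∀ {n m} {Γ : List (Fm n m)} k {x} → Γ ⊩ x <' num k → Γ ⊩ one-of-first k x
  below-num k {x} p = ∃ₙE (<-E p) (cast (sym (wkN-one-of-first k x))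
    (⇒E (below-num-step k (var zero) (renT suc x))
      (cast (cong (S (var zero) ⊕ renT suc x ≐_) (renT-num suc k)) hyp₀)))

  -- This places every number not among 0, ..., k above k, including nonstandard ones. The induction
  -- on k is again external and passes to the predecessor that `Q3` provides.
  above-num : ∀ {n m} {Γ : List (Fm n m)} k x → Γ ⊩ ¬' (one-of-first (suc k) x) ⇒ (num k <' x)
  above-num k x = ⇒I (∃ₙE (predecessor (⇒I (⇒E hyp₁ (one-of-first-I (suc k) 0 (s≤s z≤n) hyp₀))))
      (cast (sym (cong₂ _<'_ (substT-num _ k) (substT-var-suc x)))
        (body k (cast (cong ¬' (wkN-one-of-first (suc k) x)) hyp₁))))
    where
    x' = renT suc x
    body : ∀ {Γ} k → (x' ≐ S (var zero)) ∷ Γ ⊩ ¬' (one-of-first (suc k) x') →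
           (x' ≐ S (var zero)) ∷ Γ ⊩ num k <' x'
    body zero p = <-I (var zero) (≐-trans (⊕-zer _) (≐-sym hyp₀))
    body (suc k) p = ∃ₙE
      (<-E (⇒E (above-num k (var zero)) (⇒I (⇒E (wk p) (one-of-first-suc (suc k) hyp₁ hyp₀)))))
      (cast (sym (cong₂ _<'_ (substT-num _ (suc k)) (substT-var-suc x')))
        (<-I (var zero) (≐-trans (⊕-S _ _) (≐-trans
          (S-cong (cast (cong (λ l → S (var zero) ⊕ l ≐ var (suc zero)) (renT-num suc k)) hyp₀))
          (≐-sym (cast (cong (_≐ S (var (suc zero))) (substT-var-suc x')) hyp₁))))))

  -- Both halves are proved together because negation exchanges them. Asking only that σ be numerals
  -- pointwise lets the statement apply to extended substitutions under a quantifier.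
  decide : ∀ {n n' m} {Γ : List (Fm n' m)} φ (σ : Fin n → Tm n') (ρ : Fin n → ℕ) → (∀ i → σ i ≡ num (ρ i)) →
           (Holds ρ φ → Γ ⊩ substF σ ⌊ φ ⌋) × (¬ Holds ρ φ → Γ ⊩ ¬' (substF σ ⌊ φ ⌋))
  decide {Γ = Γ} (eqB s t) σ ρ eqs = true , false
    where
    true : evT ρ s ≡ evT ρ t → Γ ⊩ substT σ s ≐ substT σ t
    true p = ≐-trans (evaluate σ ρ eqs s)
      (cast (cong (λ k → num k ≐ substT σ t) (sym p)) (≐-sym (evaluate σ ρ eqs t)))
    false : ¬ (evT ρ s ≡ evT ρ t) → Γ ⊩ ¬' (substT σ s ≐ substT σ t)
    false p = ⇒I (num-≢ _ _ p (≐-trans (≐-sym (evaluate σ ρ eqs s)) (≐-trans hyp₀ (evaluate σ ρ eqs t))))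
  decide {Γ = Γ} (ltB s t) σ ρ eqs = true , false
    where
    <-congˡ : ∀ {Γ s s' t} → Γ ⊩ s ≐ s' → Γ ⊩ s <' t → Γ ⊩ s' <' t
    <-congˡ {s = s} {s'} {t} p q = cast (cong (s' <'_) (sub0-renT s' t))
      (substₙ (var zero <' renT suc t) p (cast (cong (s <'_) (sym (sub0-renT s t))) q))
    true : evT ρ s < evT ρ t → Γ ⊩ substT σ s <' substT σ t
    true p = <-congˡ (≐-sym (evaluate σ ρ eqs s)) (<-congʳ (≐-sym (evaluate σ ρ eqs t)) (num-< _ _ p))
    false : ¬ (evT ρ s < evT ρ t) → Γ ⊩ ¬' (substT σ s <' substT σ t)
    false p = ⇒I (one-of-first-E (evT ρ t)
      (below-num _ (<-congˡ (evaluate σ ρ eqs s) (<-congʳ (evaluate σ ρ eqs t) hyp₀)))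
      (λ j j<t → num-≢ (evT ρ s) j (λ e → p (subst (_< evT ρ t) (sym e) j<t)) hyp₀))
  decide (negB φ) σ ρ eqs =
    (λ p → proj₂ (decide φ σ ρ eqs) p) ,
    (λ p → ¬¬I (proj₁ (decide φ σ ρ eqs) (decidable-stable (holds? ρ φ) p)))
  decide {Γ = Γ} (andB φ ψ) σ ρ eqs = (λ (p , q) → ∧I (proj₁ (decide φ σ ρ eqs) p) (proj₁ (decide ψ σ ρ eqs) q)) , false
    where
    false : ¬ (Holds ρ φ × Holds ρ ψ) → Γ ⊩ ¬' (substF σ ⌊ φ ⌋ ∧' substF σ ⌊ ψ ⌋)
    false p with holds? ρ φ
    ... | yes q = ⇒I (⇒E (proj₂ (decide ψ σ ρ eqs) (λ r → p (q , r))) (∧E₂ hyp₀))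
    ... | no q = ⇒I (⇒E (proj₂ (decide φ σ ρ eqs) q) (∧E₁ hyp₀))
  decide {n' = n'} {m} {Γ = Γ} (exB t φ) σ ρ eqs = true , false
    where
    true : Holds ρ (exB t φ) → Γ ⊩ substF σ ⌊ exB t φ ⌋
    true (k , k<t , p) = ⇒I (⇒E
      (⇒E (∀ₙE-sub {σ = σ} ((var zero <' renT suc t) ⇒ ¬' ⌊ φ ⌋) hyp₀ (num k))
        (cast (cong (num k <'_) (sym (substT-renT (num k ∷ₛ σ) suc t)))
          (<-congʳ (≐-sym (evaluate σ ρ eqs t)) (num-< k (evT ρ t) k<t))))
      (proj₁ (decide φ (num k ∷ₛ σ) (k ∷ₛ ρ) (λ { zero → refl ; (suc i) → eqs i })) p))
    false : ¬ Holds ρ (exB t φ) → Γ ⊩ ¬' (substF σ ⌊ exB t φ ⌋)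
    -- By `below-num` a witness would be one of finitely many numerals, each refuted by the
    -- induction hypothesis.
    false p = ¬¬I (∀ₙI (⇒I (one-of-first-E (evT ρ t)
      (below-num (evT ρ t) (<-congʳ (cast (cong (_≐ num (evT ρ t)) (sym (substT-renT (liftS σ) suc t)))
        (evaluate (liftS σ ∘ suc) ρ (λ i → ≡-trans (cong (renT suc) (eqs i)) (renT-num suc (ρ i))) t)) hyp₀))
      (λ j j<t → ⇒I (⇒E
        (proj₂ (decide φ (liftS σ [ zero ≔ num j ]) (j ∷ₛ ρ)
          (λ { zero → refl ; (suc i) → ≡-trans (cong (renT suc) (eqs i)) (renT-num suc (ρ i)) }))
          (λ q → p (j , j<t , q)))
        (replace ⌊ φ ⌋ (liftS σ) zero hyp₁ hyp₀))))))

-- The liar sentence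

tower : ∀ {n} → ℕ → Tm n → Tm n → Tm n
tower zero s u = u
tower (suc k) s u = s ⊗ tower k s u

substT-tower : ∀ {n n'} (σ : Fin n → Tm n') k s u → substT σ (tower k s u) ≡ tower k (substT σ s) (substT σ u)
substT-tower σ zero s u = refl
substT-tower σ (suc k) s u = cong (substT σ s ⊗_) (substT-tower σ k s u)

-- Codes of numerals and of the self-naming term

-- Prefixing `S` sends a code c to 8c + 4, which multiplies 7c + 4 by 8; the code of `zer` is 2,
-- whence 18.
codeT-num : ∀ {n} k → codeT (num {n} k) * 7 + 4 ≡ 8 ^ k * 18
codeT-num zero = refl
codeT-num {n} (suc k) = ≡-trans (step (codeT (num {n} k))) (≡-trans (cong (8 *_) (codeT-num {n} k)) (sym (*-assoc 8 (8 ^ k) 18)))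
  where
  step : ∀ c → 4 * suc (2 * c) * 7 + 4 ≡ 8 * (c * 7 + 4)
  step = solve-∀

-- With `codeT-tower-large` this yields the hypothesis `large` of `Pinned`.
codeT-num-large : ∀ {n} k → k * 4 ≤ codeT (num {n} k)
codeT-num-large zero = z≤n
codeT-num-large {n} (suc k) = ≤-trans (+-monoʳ-≤ 4 (≤-trans (codeT-num-large {n} k) (m≤m*n c 8))) (≤-reflexive (step c))
  where
  c = codeT (num {n} k)
  step : ∀ c → 4 + c * 8 ≡ 4 * suc (2 * c)
  step = solve-∀

-- The left side is the code of `var (# 1) ⊗ t` for t of code c; the variable has code 3, whence the
-- factor 8.
codeT-tower-step : ∀ c → 16 * suc (2 * (8 * suc (2 * c))) ≡ 512 * c + 272
codeT-tower-step = solve-∀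

-- The map taking c to 512c + 272 multiplies 511c + 272 by 512.
codeT-tower : ∀ {n} k (u : Tm (2 + n)) → codeT (tower k (var (# 1)) u) * 511 + 272 ≡ 512 ^ k * (codeT u * 511 + 272)
codeT-tower zero u = sym (+-identityʳ _)
codeT-tower (suc k) u = ≡-trans (cong (λ c → c * 511 + 272) (codeT-tower-step (codeT (tower k (var (# 1)) u))))
    (≡-trans (step (codeT (tower k (var (# 1)) u))) (≡-trans (cong (512 *_) (codeT-tower k u)) (sym (*-assoc 512 (512 ^ k) _))))
  where
  step : ∀ c → (512 * c + 272) * 511 + 272 ≡ 512 * (c * 511 + 272)
  step = solve-∀

codeT-tower-large : ∀ {n} k (u : Tm (2 + n)) → codeT u ≤ codeT (tower k (var (# 1)) u)
codeT-tower-large zero u = ≤-refl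
codeT-tower-large (suc k) u = ≤-trans (codeT-tower-large k u)
  (≤-trans (m≤n*m c 512) (≤-trans (m≤m+n (512 * c) 272) (≤-reflexive (sym (codeT-tower-step c)))))
  where
  c = codeT (tower k (var (# 1)) u)

-- Adding 20 to 511k + 272 makes it 73(7k + 4), to which `codeT-num` applies; 1314 is 18 · 73, and
-- 512 and 8 are the powers of two with exponents 9 and 3.
codeEquation : ∀ {n} N V → V ≡ 2 ^ N → CodeEquation V (codeT (tower N (var (# 1)) (num {2 + n} N)))
codeEquation {n} N V V≡ = begin
  c * 511 + 272 + V ^ 9 * 20              ≡⟨ cong₂ (λ x y → x + y * 20) (codeT-tower N (num N)) V⁹ ⟩
  E * (k * 511 + 272) + E * 20            ≡⟨ step₁ E k ⟩
  E * ((k * 7 + 4) * 73)                  ≡⟨ cong (λ x → E * (x * 73)) (codeT-num {2 + n} N) ⟩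
  E * (8 ^ N * 18 * 73)                   ≡⟨ step₂ E (8 ^ N) ⟩
  E * 8 ^ N * 1314                        ≡⟨ cong (_* 1314) V¹² ⟩
  V ^ 12 * 1314                           ∎
  where
  open ≡-Reasoning
  c = codeT (tower N (var (# 1)) (num {2 + n} N))
  k = codeT (num {2 + n} N)
  E = 512 ^ N
  swap : ∀ e → V ^ e ≡ (2 ^ e) ^ N
  swap e = ≡-trans (cong (_^ e) V≡) (≡-trans (^-*-assoc 2 N e) (≡-trans (cong (2 ^_) (*-comm N e)) (sym (^-*-assoc 2 e N))))
  V⁹ : V ^ 9 ≡ E
  V⁹ = swap 9
  V¹² : E * 8 ^ N ≡ V ^ 12
  V¹² = ≡-trans (cong₂ _*_ (sym V⁹) (sym (swap 3))) (sym (^-distribˡ-+-* V 9 3))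
  step₁ : ∀ e k → e * (k * 511 + 272) + e * 20 ≡ e * ((k * 7 + 4) * 73)
  step₁ = solve-∀
  step₂ : ∀ e f → e * (f * 18 * 73) ≡ e * f * 1314
  step₂ = solve-∀

-- The liar as a formula

oddFactorFree : ∀ {n} → Tm n → Bounded n
oddFactorFree t = negB (exB (S t) (exB (S (renT suc t))
  (eqB ((var (# 1) ⊗ num 2 ⊕ num 3) ⊗ var (# 0)) (renT suc (renT suc t)))))

_^T_ : ∀ {n} → Tm n → ℕ → Tm n
t ^T zero = S zer
t ^T suc k = t ⊗ (t ^T k)

-- The existential quantifiers bind V, c, d, r, s of Certificate in this order.
certificateB : ∀ {n} (x u w h : Fin n) → Bounded n
certificateB {n} x u w h =
  exB (S (var u)) (exB (S (var (suc u))) (exB (S (var (suc (suc u)))) (exB (S (var (suc (suc (suc u)))))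
  (exB (S (var (suc (suc (suc (suc u))))))
    (andB (eqB (var (up x)) (V ⊗ N))
    (andB (oddFactorFree V)
    (andB (eqB (c ⊗ num 511 ⊕ num 272 ⊕ (V ^T 9) ⊗ num 20) ((V ^T 12) ⊗ num 1314))
    (andB (eqB (S d) (V ^T 16))
    (andB (oddFactorFree (var (up u)))
    (andB (eqB (var (up u)) (S (g ⊗ d ⊕ r ⊗ (d ⊗ d))))
    (andB (oddFactorFree (S (var (up w))))
    (andB (eqB (var (up u)) (S (N ⊗ num 16 ⊗ var (up w) ⊕ s ⊗ (var (up w) ⊗ var (up w)))))
         (ltB (N ⊗ num 16 ⊗ g) (var (up w)))))))))))))))
  where
  up : Fin n → Fin (5 + n)
  up i = suc (suc (suc (suc (suc i))))
  V c d r s N g : Tm (5 + n)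
  s = var (# 0)
  r = var (# 1)
  d = var (# 2)
  c = var (# 3)
  V = var (# 4)
  N = S (var (up h) ⊗ num 2)
  g = c ⊗ num 8 ⊕ num 5

-- `Certificate` has exactly the shape to which `Holds` computes, so both directions are the
-- identity.
certificateB-sound : ∀ {n} (ρ : Fin n → ℕ) x u w h →
  Holds ρ (certificateB x u w h) → Certificate (ρ x) (ρ u) (ρ w) (ρ h)
certificateB-sound ρ x u w h p = p

certificateB-complete : ∀ {n} (ρ : Fin n → ℕ) x u w h →
  Certificate (ρ x) (ρ u) (ρ w) (ρ h) → Holds ρ (certificateB x u w h)
certificateB-complete ρ x u w h p = p

pairT : ∀ {n} → ℕ → Tm n → Tm n
pairT k t = num (2 ^ k) ⊗ S (num 2 ⊗ t)

evT-pairT : ∀ {n} (ρ : Fin n → ℕ) k t → evT ρ (pairT k t) ≡ pair k (evT ρ t)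
evT-pairT ρ k t = cong (_* suc (2 * evT ρ t)) (evT-num ρ (2 ^ k))

prefixT : ∀ {n} → List ℕ → Tm n → Tm n
prefixT [] t = t
prefixT (k ∷ ks) t = pairT k (prefixT ks t)

-- Abstract, because unfolding these numbers is infeasible.
abstract
  prefix : List ℕ → ℕ → ℕ
  prefix [] j = j
  prefix (k ∷ ks) j = pair k (prefix ks j)

  prefix-[] : ∀ j → prefix [] j ≡ j
  prefix-[] j = refl

  prefix-∷ : ∀ k ks j → prefix (k ∷ ks) j ≡ pair k (prefix ks j)
  prefix-∷ k ks j = refl

evT-prefixT : ∀ {n} (ρ : Fin n → ℕ) ks t → evT ρ (prefixT ks t) ≡ prefix ks (evT ρ t)
evT-prefixT ρ [] t = sym (prefix-[] (evT ρ t))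
evT-prefixT ρ (k ∷ ks) t = ≡-trans (evT-pairT ρ k (prefixT ks t))
  (≡-trans (cong (pair k) (evT-prefixT ρ ks t)) (sym (prefix-∷ k ks (evT ρ t))))

-- The tags that gn writes for ∀ᵢ, five ∀ₙ, and ⇒.
tags : List ℕ
tags = 8 ∷ 7 ∷ 7 ∷ 7 ∷ 7 ∷ 7 ∷ 6 ∷ []

-- In the scope of the five number quantifiers of the liar sentence:
-- x = 0, z = 1 (pinned to 2), u = 2, w = 3, h = 4.
ownCode : Tm 5
ownCode = prefixT tags (S (var (# 3)) ⊗ S (num 2 ⊗ var (# 4)))

-- The bounds of w and h by u make both of them numerals as soon as u is one.
matrix : Bounded 5
matrix = andB (eqB (var (# 1)) (num 2)) (andB (ltB (var (# 3)) (S (var (# 2)))) (andB (ltB (var (# 4)) (S (var (# 2))))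
  (certificateB (# 0) (# 2) (# 3) (# 4))))

-- Variable 0 is the candidate u and variable 1 is x; the quantifiers bind w, then h.
hasCertificate : Bounded 2
hasCertificate = exB (S (var (# 0))) (exB (S (var (# 1))) (certificateB (# 3) (# 2) (# 1) (# 0)))

smaller : Fin 2 → Tm 6
smaller = var (# 0) ∷ₛ var (# 1) ∷ₛ λ ()

-- Being instantiable at the numeral of the true witness, it also excludes nonstandard u.
least : ∀ {m} → Fm 5 m
least = ∀ₙ ((var (# 0) <' var (# 3)) ⇒ ¬' (substF smaller ⌊ hasCertificate ⌋))

core : ∀ {m} → Fin m → Fm 5 m
core a = ⌊ matrix ⌋ ⇒ least ⇒ ¬' (T a ownCode)

untrue : ∀ {m} → ℕ → Fin m → Fm 0 m
untrue N a = ∀ₙ (∀ₙ (∀ₙ (∀ₙ (∀ₙ ((var (# 0) ≐ tower N (var (# 1)) (num N)) ⇒ core a)))))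

liar : ℕ → Sentence
liar N = ∀ᵢ (untrue N zero)

renI-⌊⌋₀ : ∀ {n m m'} (f : Fin m → Fin m') (φ : Bounded n) → renI f ⌊ φ ⌋ ≡ ⌊ φ ⌋
renI-⌊⌋₀ f φ = ≡-trans (cong (renI f) (sym (substF-id (λ _ → refl) ⌊ φ ⌋)))
  (≡-trans (renI-⌊⌋ f var φ) (substF-id (λ _ → refl) ⌊ φ ⌋))

rel-⌊⌋₀ : ∀ {n m} (b : Fin m) (φ : Bounded n) → rel b ⌊ φ ⌋ ≡ ⌊ φ ⌋
rel-⌊⌋₀ b φ = ≡-trans (cong (rel b) (sym (substF-id (λ _ → refl) ⌊ φ ⌋)))
  (≡-trans (rel-⌊⌋ b var φ) (substF-id (λ _ → refl) ⌊ φ ⌋))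

-- Renaming and relativisation meet only the two bounded subformulas and the index of `T`; once the
-- former are known to be fixed, the rest computes.
untrue-cong : ∀ {m} N (a : Fin m) {μ κ} → μ ≡ ⌊ matrix ⌋ → κ ≡ substF smaller ⌊ hasCertificate ⌋ →
  ∀ₙ (∀ₙ (∀ₙ (∀ₙ (∀ₙ ((var (# 0) ≐ tower N (var (# 1)) (num N)) ⇒
    μ ⇒ ∀ₙ ((var (# 0) <' var (# 3)) ⇒ ¬' κ) ⇒ ¬' (T a ownCode)))))) ≡ untrue N a
untrue-cong N a refl refl = refl

renI-untrue : ∀ {m m'} N (f : Fin m → Fin m') a → renI f (untrue N a) ≡ untrue N (f a)
renI-untrue N f a = untrue-cong N (f a) (renI-⌊⌋₀ f matrix) (renI-⌊⌋ f smaller hasCertificate)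

rel-untrue : ∀ {m} N (b a : Fin m) → rel b (untrue N a) ≡ untrue N a
rel-untrue N b a = untrue-cong N a (rel-⌊⌋₀ b matrix) (rel-⌊⌋ b smaller hasCertificate)

-- The code of the liar

-- Variable 0 has code 1, so the equation has code 1 + 2 · 2(1 + 2c) = 8c + 5, which `pair` turns
-- into an exponent of 2.
gn-≐⇒ : ∀ {n m} (t : Tm (suc n)) (ψ : Fm (suc n) m) →
        gn ((var (# 0) ≐ t) ⇒ ψ) ≡ pair 6 (2 ^ (codeT t * 8 + 5) * suc (2 * gn ψ))
gn-≐⇒ t ψ = cong (λ e → pair 6 (2 ^ e * suc (2 * gn ψ))) {pair 0 (pair 1 (codeT t))} {codeT t * 8 + 5}
              (exponent (codeT t))
  where
  exponent : ∀ c → 1 * suc (2 * (2 * suc (2 * c))) ≡ c * 8 + 5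
  exponent = solve-∀

-- An opaque copy of `gn`, so that type checking never evaluates the code of a large formula.
abstract
  code : ∀ {n m} → Fm n m → ℕ
  code = gn

  code≡gn : ∀ {n m} (φ : Fm n m) → code φ ≡ gn φ
  code≡gn φ = refl

  1≤code-⇒ : ∀ {n m} (φ ψ : Fm n m) → 1 ≤ code (φ ⇒ ψ)
  1≤code-⇒ φ ψ = s≤s z≤n

  code-∀ₙ : ∀ {n m} ks j (φ : Fm (suc n) m) → code φ ≡ prefix ks j → code (∀ₙ φ) ≡ prefix (7 ∷ ks) j
  code-∀ₙ ks j φ p = cong (pair 7) {gn φ} {prefix ks j} p

  code-∀ᵢ : ∀ {n m} ks j (φ : Fm n (suc m)) → code φ ≡ prefix ks j → code (∀ᵢ φ) ≡ prefix (8 ∷ ks) j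
  code-∀ᵢ ks j φ p = cong (pair 8) {gn φ} {prefix ks j} p

  code-≐⇒ : ∀ {n m} (t : Tm (suc n)) (ψ : Fm (suc n) m) →
            code ((var (# 0) ≐ t) ⇒ ψ) ≡ prefix (6 ∷ []) (2 ^ (codeT t * 8 + 5) * suc (2 * code ψ))
  code-≐⇒ = gn-≐⇒

code-closure : ∀ j (φ : Fm 5 1) → code φ ≡ prefix (6 ∷ []) j →
               code (∀ᵢ (∀ₙ (∀ₙ (∀ₙ (∀ₙ (∀ₙ φ)))))) ≡ prefix tags j
code-closure j φ p = code-∀ᵢ _ j _ (code-∀ₙ _ j _ (code-∀ₙ _ j _ (code-∀ₙ _ j _ (code-∀ₙ _ j _ (code-∀ₙ (6 ∷ []) j φ p)))))

-- Diagonalisation inside the theory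

module Diagonal (Ax : Theory) (itb : ∀ {φ} → ITB φ → Ax φ) (h N V a q G : ℕ) (h≡ : code (core {1} zero) ≡ h)
                (N≡ : N ≡ suc (h * 2)) (V≡ : V ≡ 2 ^ N) (a≡ : a ≡ N * 16) (q≡ : q ≡ V ^ 16)
                (G≡ : code (liar N) ≡ G) where

  open Robinson Ax itb

  self : Tm 5
  self = tower N (var (# 1)) (num N)

  open Pinned h (codeT self) N V a q N≡ V≡ a≡ q≡
    (subst (1 ≤_) h≡ (1≤code-⇒ ⌊ matrix ⌋ (least ⇒ ¬' (T zero ownCode))))
    (codeEquation {3} N V V≡)
    (≤-trans (codeT-num-large {5} N) (codeT-tower-large N (num N)))

  env : ℕ → ℕ → ℕ → Fin 5 → ℕ
  env u w h = V * N ∷ₛ 2 ∷ₛ u ∷ₛ w ∷ₛ h ∷ₛ λ ()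

  numerals : ∀ {n n'} → (Fin n → ℕ) → Fin n → Tm n'
  numerals ρ i = num (ρ i)

  -- The fixed point: `suc w` is 2 to the code of the equation `x ≐ self` and h is the code of the
  -- core, so the term rebuilds the code of the whole liar.
  ownCode-value : evT (env U w h) ownCode ≡ G
  ownCode-value = ≡-trans (evT-prefixT (env U w h) tags (S (var (# 3)) ⊗ S (num 2 ⊗ var (# 4))))
    (≡-trans (cong (prefix tags) (cong₂ (λ x y → x * suc (2 * y)) (suc-pred (2 ^ g) {{m^n≢0 2 g}}) (sym h≡)))
      (≡-trans (sym (code-closure _ ((var (# 0) ≐ self) ⇒ core zero) (code-≐⇒ self (core zero)))) G≡))

  matrix-true : Holds (env U w h) matrix
  matrix-true = refl , s≤s w≤U , s≤s h≤U , certificateB-complete (env U w h) (# 0) (# 2) (# 3) (# 4) certificate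

  matrix-unique : ∀ {u w' h'} → u ≤ U → Holds (env u w' h') matrix → u ≡ U × w' ≡ w × h' ≡ h
  matrix-unique {u} {w'} {h'} u≤U (_ , _ , _ , p) =
    certificate-unique u w' h' u≤U (certificateB-sound (env u w' h') (# 0) (# 2) (# 3) (# 4) p)

  pairEnv : ℕ → Fin 2 → ℕ
  pairEnv u = u ∷ₛ V * N ∷ₛ λ ()

  hasCertificate-true : Holds (pairEnv U) hasCertificate
  hasCertificate-true = w , s≤s w≤U , h , s≤s h≤U ,
    certificateB-complete (h ∷ₛ w ∷ₛ pairEnv U) (# 3) (# 2) (# 1) (# 0) certificate

  hasCertificate-false : ∀ {u} → u < U → ¬ Holds (pairEnv u) hasCertificate
  hasCertificate-false {u} u<U (w' , _ , h' , _ , p) = <-irrefl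
    (proj₁ (certificate-unique u w' h' (<⇒≤ u<U)
      (certificateB-sound (h' ∷ₛ w' ∷ₛ pairEnv u) (# 3) (# 2) (# 1) (# 0) p))) u<U

  tower-value : ∀ {n m} {Γ : List (Fm n m)} {s} k j → Γ ⊩ s ≐ num 2 → Γ ⊩ tower k s (num j) ≐ num (2 ^ k * j)
  tower-value zero j p = cast (cong (λ l → num j ≐ num l) (sym (+-identityʳ j))) (reflₙ _)
  tower-value {s = s} (suc k) j p = cast (cong (λ l → tower (suc k) s (num j) ≐ num l) (sym (*-assoc 2 (2 ^ k) j)))
    (≐-trans (⊗-cong p (tower-value k j p)) (num-⊗ 2 (2 ^ k * j)))

  self-value : ∀ {n m} {Γ : List (Fm n m)} {s} → Γ ⊩ s ≐ num 2 → Γ ⊩ tower N s (num N) ≐ num (V * N)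
  self-value {s = s} p = cast (cong (λ l → tower N s (num N) ≐ num (l * N)) (sym V≡)) (tower-value N N p)

  ownCode-≐ : ∀ {n m} {Γ : List (Fm n m)} (σ : Fin 5 → Tm n) → (∀ i → σ i ≡ num (env U w h i)) → Γ ⊩ substT σ ownCode ≐ num G
  ownCode-≐ σ eqs = cast (cong (λ l → substT σ ownCode ≐ num l) ownCode-value) (evaluate σ (env U w h) eqs ownCode)

  private
    core-at-numerals : ∀ {m} {Γ : List (Fm 0 m)} (b : Fin m) → Γ ⊩ untrue N b →
      Γ ⊩ substF (numerals (env U w h)) ((var (# 0) ≐ self) ⇒ core b)
    core-at-numerals b p = cast (substF-ext (λ { zero → refl ; (suc zero) → refl ; (suc (suc zero)) → refl
        ; (suc (suc (suc zero))) → refl ; (suc (suc (suc (suc zero)))) → refl }) φ)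
      (∀ₙE-sub {σ = σ₄} φ (∀ₙE-sub {σ = σ₃} (∀ₙ φ) (∀ₙE-sub {σ = σ₂} (∀ₙ (∀ₙ φ))
        (∀ₙE-sub {σ = σ₁} (∀ₙ (∀ₙ (∀ₙ φ))) (∀ₙE-sub {σ = σ₀} (∀ₙ (∀ₙ (∀ₙ (∀ₙ φ))))
          (cast (sym (substF-id (λ ()) (untrue N b))) p) (num h)) (num w)) (num U)) (num 2)) (num (V * N)))
      where
      φ = (var (# 0) ≐ self) ⇒ core b
      σ₀ : Fin 0 → Tm 0
      σ₀ ()
      σ₁ = num h ∷ₛ σ₀
      σ₂ = num w ∷ₛ σ₁
      σ₃ = num U ∷ₛ σ₂
      σ₄ = num 2 ∷ₛ σ₃

    self-at-numerals : ∀ {m} {Γ : List (Fm 0 m)} → Γ ⊩ num (V * N) ≐ substT (numerals (env U w h)) self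
    self-at-numerals = ≐-sym (cast
      (cong (_≐ num (V * N)) (sym (≡-trans (substT-tower _ N (var (# 1)) (num N)) (cong (tower N (num 2)) (substT-num _ N)))))
      (self-value (reflₙ (num 2))))

    least-at-numerals : ∀ {m} {Γ : List (Fm 0 m)} → Γ ⊩ substF (numerals (env U w h)) least
    least-at-numerals = ∀ₙI (⇒I (one-of-first-E U
      (below-num U (cast (cong (var zero <'_) (renT-num suc U)) hyp₀))
      λ j j<U → ⇒I (⇒E
        (proj₂ (decide hasCertificate (τ [ zero ≔ num j ]) (pairEnv j)
          (λ { zero → refl ; (suc zero) → renT-num suc (V * N) })) (hasCertificate-false j<U))
        (replace ⌊ hasCertificate ⌋ τ zero hyp₁ (cast (substF-substF (liftS (numerals (env U w h))) smaller ⌊ hasCertificate ⌋) hyp₀)))))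
      where
      τ : Fin 2 → Tm 1
      τ = substT (liftS (numerals (env U w h))) ∘ smaller

  -- At the true values all premises of the core are provable, and `ownCode` equals the numeral of
  -- `G`.
  untrue⇒¬T : ∀ {m} {Γ : List (Fm 0 m)} (b : Fin m) → Γ ⊩ untrue N b → Γ ⊩ ¬' (T b (num G))
  untrue⇒¬T b p = ⇒I (⇒E
    (⇒E (⇒E (⇒E (wk (core-at-numerals b p)) self-at-numerals)
      (proj₁ (decide matrix (numerals (env U w h)) (env U w h) (λ _ → refl)) matrix-true)) least-at-numerals)
    (T-cong (≐-sym (ownCode-≐ (numerals (env U w h)) (λ _ → refl))) hyp₀))

  module _ {m} (b : Fin m) where

    at-numerals : ∀ {Γ} {u' w' h'} (φ : Fm 5 m) → Γ ⊩ var (# 0) ≐ num (V * N) → Γ ⊩ var (# 1) ≐ num 2 →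
      Γ ⊩ var (# 2) ≐ num u' → Γ ⊩ var (# 3) ≐ num w' → Γ ⊩ var (# 4) ≐ num h' →
      Γ ⊩ φ → Γ ⊩ substF (numerals (env u' w' h')) φ
    at-numerals {u' = u'} {w'} {h'} φ px pz pu pw ph p = cast
      (substF-ext (λ { zero → refl ; (suc zero) → refl ; (suc (suc zero)) → refl
        ; (suc (suc (suc zero))) → refl ; (suc (suc (suc (suc zero)))) → refl }) φ)
      (replace φ σ₄ (# 4) ph (replace φ σ₃ (# 3) pw (replace φ σ₂ (# 2) pu (replace φ σ₁ (# 1) pz
        (replace φ var (# 0) px (cast (sym (substF-id (λ _ → refl) φ)) p))))))
      where
      σ₁ = var [ # 0 ≔ num (V * N) ]
      σ₂ = σ₁ [ # 1 ≔ num 2 ]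
      σ₃ = σ₂ [ # 2 ≔ num u' ]
      σ₄ = σ₃ [ # 3 ≔ num w' ]

    not-above : {Γ : List (Fm 5 m)} → Γ ⊩ var (# 0) ≐ num (V * N) → Γ ⊩ least → Γ ⊩ num U <' var (# 2) → Γ ⊩ ⊥'
    not-above px pl p = ⇒E (⇒E (∀ₙE pl (num U)) p) (cast
      (≡-trans (substF-ext {σ = numerals (pairEnv U) [ # 1 ≔ var (# 0) ]} {τ = substT (sub0 (num U)) ∘ smaller}
          (λ { zero → refl ; (suc zero) → refl }) ⌊ hasCertificate ⌋)
        (sym (substF-substF (sub0 (num U)) smaller ⌊ hasCertificate ⌋)))
      (replace ⌊ hasCertificate ⌋ (numerals (pairEnv U)) (# 1) (≐-sym px)
        (proj₁ (decide hasCertificate (numerals (pairEnv U)) (pairEnv U) (λ _ → refl)) hasCertificate-true)))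

    -- If u is at most `U`, then u, w and h are numerals: either `matrix` is refuted there, or
    -- uniqueness makes them the true values. A u above `U` contradicts `least`.
    pinned : ∀ {Γ} → Γ ⊩ var (# 0) ≐ self → Γ ⊩ ⌊ matrix ⌋ → Γ ⊩ least → Γ ⊩ T b ownCode → Γ ⊩ T b (num G)
    pinned {Γ} ps pm pl pT = cases (one-of-first (suc U) (var (# 2)))
      (one-of-first-E (suc U) hyp₀ λ u' u'≤U →
       one-of-first-E (suc u') (below-num (suc u') (<-congʳ (S-cong hyp₀) (wk (wk w<)))) λ w' _ →
       one-of-first-E (suc u') (below-num (suc u') (<-congʳ (S-cong hyp₁) (wk (wk (wk h<))))) λ h' _ →
       standard u' w' h' (≤-pred u'≤U) (wk (wk (wk (wk px)))) (wk (wk (wk (wk pz)))) hyp₂ hyp₁ hyp₀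
         (wk (wk (wk (wk pm)))) (wk (wk (wk (wk pT)))))
      (absurd (not-above (wk px) (wk pl) (⇒E (above-num U (var (# 2))) hyp₀)))
      where
      pz : Γ ⊩ var (# 1) ≐ num 2
      pz = ∧E₁ pm
      w< : Γ ⊩ var (# 3) <' S (var (# 2))
      w< = ∧E₁ (∧E₂ pm)
      h< : Γ ⊩ var (# 4) <' S (var (# 2))
      h< = ∧E₁ (∧E₂ (∧E₂ pm))
      px : Γ ⊩ var (# 0) ≐ num (V * N)
      px = ≐-trans ps (self-value pz)
      standard : ∀ {Δ} u' w' h' → u' ≤ U → Δ ⊩ var (# 0) ≐ num (V * N) → Δ ⊩ var (# 1) ≐ num 2 →
        Δ ⊩ var (# 2) ≐ num u' → Δ ⊩ var (# 3) ≐ num w' → Δ ⊩ var (# 4) ≐ num h' →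
        Δ ⊩ ⌊ matrix ⌋ → Δ ⊩ T b ownCode → Δ ⊩ T b (num G)
      standard {Δ} u' w' h' u'≤U px pz pu pw ph pm pT = by-cases (holds? (env u' w' h') matrix)
        where
        env-cong : u' ≡ U × w' ≡ w × h' ≡ h → ∀ i → num {5} (env u' w' h' i) ≡ num (env U w h i)
        env-cong (refl , refl , refl) i = refl
        by-cases : Dec (Holds (env u' w' h') matrix) → Δ ⊩ T b (num G)
        by-cases (no ¬p) = absurd (⇒E
          (proj₂ (decide matrix (numerals (env u' w' h')) (env u' w' h') (λ _ → refl)) ¬p)
          (at-numerals ⌊ matrix ⌋ px pz pu pw ph pm))
        by-cases (yes p) = T-cong (ownCode-≐ (numerals (env u' w' h')) (env-cong (matrix-unique u'≤U p)))
          (at-numerals (T b ownCode) px pz pu pw ph pT)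

    ¬T⇒untrue : ∀ {Γ} → Γ ⊩ ¬' (T b (num G)) → Γ ⊩ untrue N b
    -- The premise enters as a hypothesis so that it follows the five context weakenings; its
    -- numeral is then shown to be `unchanged`.
    ¬T⇒untrue p = ⇒E (⇒I (∀ₙI (∀ₙI (∀ₙI (∀ₙI (∀ₙI (⇒I (⇒I (⇒I (⇒I
      (⇒E (cast (cong (λ t → ¬' (T b t)) unchanged) (hyp (there (there (there (there (here refl)))))))
        (pinned (hyp (there (there (there (here refl))))) hyp₂ hyp₁ hyp₀)))))))))))) p
      where
      s : ∀ {n} → Tm n → Tm (suc n)
      s = substT (var ∘ suc)
      unchanged : s (s (s (s (s (num G))))) ≡ num G
      unchanged = ≡-trans (cong (s ∘ s ∘ s ∘ s) (substT-num _ G)) (≡-trans (cong (s ∘ s ∘ s) (substT-num _ G))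
        (≡-trans (cong (s ∘ s) (substT-num _ G)) (≡-trans (cong s (substT-num _ G)) (substT-num _ G))))

  -- The contradiction from the liar

  biconditional : ∀ {m} {Γ : List (Fm 0 m)} ψ {k} (b : Fin m) → code ψ ≡ k →
    Γ ⊩ T b (num k) ⇔ renI (ren0 b) (renI (liftR closeIx) (substF closeTm (rel zero (wkI ψ))))
  biconditional ψ {k} b p = cast (cong (λ t → T b t ⇔ renI (ren0 b) (renI (liftR closeIx) (substF closeTm (rel zero (wkI ψ)))))
      (≡-trans (substT-num closeTm (gn ψ)) (cong num (≡-trans (sym (code≡gn ψ)) p))))
    (∀ᵢE (ax (itb (bicond ψ))) b)

  private
    -- Only the outermost quantifier of the liar ranges over indices, so relativisation bounds that
    -- one and changes nothing inside.
    liar-biconditional : ∀ {m} {Γ : List (Fm 0 m)} (b : Fin m) →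
      Γ ⊩ T b (num G) ⇔ ∀ᵢ ((zero ≺ suc b) ⇒ untrue N zero)
    liar-biconditional b = cast (cong (λ φ → T b (num G) ⇔ ∀ᵢ ((zero ≺ suc b) ⇒ φ)) body) (biconditional (liar N) b G≡)
      where
      body : renI (liftR (ren0 b)) (renI (liftR (liftR closeIx)) (substF closeTm
               (rel (suc zero) (renI (liftR suc) (untrue N zero))))) ≡ untrue N zero
      body = begin
        renI (liftR (ren0 b)) (renI (liftR (liftR closeIx)) (substF closeTm
          (rel (suc zero) (renI (liftR suc) (untrue N zero)))))
          ≡⟨ cong (λ φ → renI (liftR (ren0 b)) (renI (liftR (liftR closeIx)) (substF closeTm (rel (suc zero) φ))))
               (renI-untrue N (liftR suc) zero) ⟩
        renI (liftR (ren0 b)) (renI (liftR (liftR closeIx)) (substF closeTm (rel (suc zero) (untrue N zero))))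
          ≡⟨ cong (λ φ → renI (liftR (ren0 b)) (renI (liftR (liftR closeIx)) (substF closeTm φ)))
               (rel-untrue N (suc zero) zero) ⟩
        renI (liftR (ren0 b)) (renI (liftR (liftR closeIx)) (substF closeTm (untrue N zero)))
          ≡⟨ cong (λ φ → renI (liftR (ren0 b)) (renI (liftR (liftR closeIx)) φ)) (substF-id (λ ()) (untrue N zero)) ⟩
        renI (liftR (ren0 b)) (renI (liftR (liftR closeIx)) (untrue N zero))
          ≡⟨ cong (renI (liftR (ren0 b))) (renI-untrue N (liftR (liftR closeIx)) zero) ⟩
        renI (liftR (ren0 b)) (untrue N zero)
          ≡⟨ renI-untrue N (liftR (ren0 b)) zero ⟩
        untrue N zero ∎
        where open ≡-Reasoning

  T-E : ∀ {m} {Γ : List (Fm 0 m)} {b c : Fin m} → Γ ⊩ T b (num G) → Γ ⊩ c ≺ b → Γ ⊩ ¬' (T c (num G))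
  T-E {b = b} {c} p q = untrue⇒¬T c (cast (renI-untrue N (ren0 c) zero)
    (⇒E (∀ᵢE (⇒E (∧E₁ (liar-biconditional b)) p) c) q))

  T-I : ∀ {m} {Γ : List (Fm 0 m)} {b : Fin m} → (zero ≺ suc b) ∷ map wkI Γ ⊩ ¬' (T zero (num G)) → Γ ⊩ T b (num G)
  T-I {b = b} p = ⇒E (∧E₂ (liar-biconditional b)) (∀ᵢI (⇒I (¬T⇒untrue zero p)))

  ∃ᵢE : ∀ {m} {Γ : List (Fm 0 m)} {φ} → Γ ⊩ ∃ᵢ φ → φ ∷ map wkI Γ ⊩ ⊥' → Γ ⊩ ⊥'
  ∃ᵢE p q = ⇒E p (∀ᵢI (⇒I q))

  noMinimal : ∀ {m} → Fm 0 m
  noMinimal = ∀ᵢ (∃ᵢ (zero ≺ suc zero))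

  nowhere-true : ∀ {m} (b : Fin m) → noMinimal ∷ [] ⊩ ¬' (T b (num G))
  nowhere-true b = ⇒I (∃ᵢE (∀ᵢE hyp₁ b)
    (⇒E (T-E hyp₁ hyp₀) (T-I (T-E hyp₂ (≺-trans hyp₀ hyp₁)))))
    where
    ≺-trans : ∀ {m} {Γ : List (Fm 0 m)} {b c d : Fin m} → Γ ⊩ b ≺ c → Γ ⊩ c ≺ d → Γ ⊩ b ≺ d
    ≺-trans {b = b} {c} {d} p q = ⇒E (∀ᵢE (∀ᵢE (∀ᵢE (ax (itb trans)) b) c) d) (∧I p q)

  -- As the existential quantifier abbreviates a negated universal, `MinimalExists` is literally the
  -- negation of `noMinimal`. Under that assumption the liar is true at no index below the given
  -- one, hence true at it.
  minimalExists : Ax NonemptyIx → Ax ⊢ MinimalExists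
  minimalExists nonempty = ⇒I (∃ᵢE (ax nonempty)
    (⇒E (weaken there (nowhere-true zero)) (T-I (weaken (there ∘ there) (nowhere-true zero)))))

minimalExists : (Ax : Theory) → (∀ {φ} → ITB φ → Ax φ) → Ax NonemptyIx → Ax ⊢ MinimalExists
minimalExists Ax itb = Diagonal.minimalExists Ax itb h N (2 ^ N) (N * 16) ((2 ^ N) ^ 16) (code (liar N)) refl refl refl refl refl refl
  where
  h N : ℕ
  h = code (core {1} zero)
  N = suc (h * 2)

theorem3p2 : ((ITB +ax NonemptyIx) ⊢ MinimalExists) × (DTB ⊢ ⊥')
theorem3p2 = minimalExists (ITB +ax NonemptyIx) inj₁ (inj₂ refl)
           -- `MinimalExists` is syntactically the negation of the axiom `NoMinimal`.
           , ⇒E (minimalExists DTB (inj₁ ∘ inj₁) (inj₂ refl)) (ax (inj₁ (inj₂ refl)))
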